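{- For every positive integer $n$, $$m_n = \sum_{\mu \vdash n} (-1)^{l(\mu)-1} c_{\mu}\, r_{\mu}, \qquad c_{\mu} = \frac{n!\,(l(\mu)-1)!}{\prod_i \mu_i!\,\prod_i n_i(\mu)!},$$ and $c_\mu$ equals the number of cyclically ordered set partitions of $[n]$ of type $\mu$, i.e. the number of ways to form a circular necklace of distinguishable beads $B_1,\dots,B_{l(\mu)}$ such that each bead $B_i$ carries a nonempty subset $S(B_i)\subseteq[n]$, the sets $S(B_i)$ form a partition of $[n]$, and the multiset $\{|S(B_1)|,\dots,|S(B_{l(\mu)})|\}$ equals the multiset of parts of $\mu$.
   Context: $m_n = \sum_i x_i^n$ is the monomial symmetric function indexed by the one-part partition $(n)$. For an integer partition $\mu$, $l(\mu)$ is its number of parts and $n_i(\mu)$ the number of parts equal to $i$. For a graph $H$, $X_H = \sum_\kappa \prod_{v} x_{\kappa(v)}$ over proper colorings $\kappa:V(H)\to\mathbb{N}$; $G_\mu$ is the complete multipartite graph with disjoint stable sets of sizes $\mu_1,\dots,\mu_{l(\mu)}$ and all edges between vertices in different stable sets; $r_\mu = X_{G_\mu}$. $[n]=\{1,\dots,n\}$. -}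

module Defs where

open import Data.Bool using (Bool; true; false; _∧_; not; if_then_else_)
open import Data.Nat using (ℕ; zero; suc; _+_; _*_; _∸_; _≤ᵇ_; _≡ᵇ_; NonZero; _!)
open import Data.Nat.Properties using (m*n≢0; _!≢0)
open import Data.Fin using (Fin; toℕ)
open import Data.List using (List; []; _∷_; [_]; map; concatMap; filterᵇ; foldr; length; upTo; allFin; _++_)
open import Data.Nat.ListAction using (sum)
open import Data.Vec using (Vec; []; _∷_; lookup)
open import Data.Integer using (+_)
open import Data.Rational using (ℚ; _/_; 0ℚ; 1ℚ; -_) renaming (_+_ to _+ℚ_)
open import Relation.Binary.PropositionalEquality using (_≡_; refl)

all : {A : Set} → (A → Bool) → List A → Bool
all p []       = true
all p (x ∷ xs) = p x ∧ all p xs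

count : {A : Set} → (A → Bool) → List A → ℕ
count p xs = length (filterᵇ p xs)

allVec : (n k : ℕ) → List (Vec (Fin k) n)
allVec zero    k = [ [] ]
allVec (suc n) k = concatMap (λ c → map (c ∷_) (allVec n k)) (allFin k)

_==F_ : {k : ℕ} → Fin k → Fin k → Bool
a ==F b = toℕ a ≡ᵇ toℕ b

occ : ℕ → List ℕ → ℕ
occ v xs = count (λ x → x ≡ᵇ v) xs

-- multiset equality: every value has the same multiplicity in both lists
-- (it suffices to test values occurring in one of the lists)
multisetEq : List ℕ → List ℕ → Bool
multisetEq xs ys = all (λ v → occ v xs ≡ᵇ occ v ys) (xs ++ ys)

-- Integer partitions, as weakly decreasing lists of positive parts

-- ptnsAux f n m : partitions of n with all parts ≤ m (fuel f ≥ n)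
ptnsAux : ℕ → ℕ → ℕ → List (List ℕ)
ptnsAux _       zero    _ = [ [] ]
ptnsAux zero    (suc n) m = []
ptnsAux (suc f) (suc n) m =
  concatMap (λ k → map (k ∷_) (ptnsAux f (suc n ∸ k) k))
            (filterᵇ (λ k → k ≤ᵇ m) (map suc (upTo (suc n))))

partitions : ℕ → List (List ℕ)
partitions n = ptnsAux n n n

_ : partitions 4 ≡ (1 ∷ 1 ∷ 1 ∷ 1 ∷ []) ∷ (2 ∷ 1 ∷ 1 ∷ []) ∷ (2 ∷ 2 ∷ []) ∷ (3 ∷ 1 ∷ []) ∷ (4 ∷ []) ∷ []
_ = refl

_ : length (partitions 10) ≡ 42
_ = refl

ℓ : List ℕ → ℕ
ℓ = length

mult : ℕ → List ℕ → ℕ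
mult i μ = occ i μ

Graph : ℕ → Set
Graph N = Fin N → Fin N → Bool

proper : {N k : ℕ} → Graph N → Vec (Fin k) N → Bool
proper {N} H κ =
  all (λ u → all (λ v → not (H u v) ∨' not (lookup κ u ==F lookup κ v)) (allFin N)) (allFin N)
  where
  _∨'_ : Bool → Bool → Bool
  true  ∨' _ = true
  false ∨' b = b

-- κ has content α, i.e. the monomial ∏_v x_{κ(v)} equals x^α = ∏_c x_c^{α c}
hasContent : {N k : ℕ} → (Fin k → ℕ) → Vec (Fin k) N → Bool
hasContent {N} {k} α κ =
  all (λ c → count (λ v → lookup κ v ==F c) (allFin N) ≡ᵇ α c) (allFin k)

-- coefficient of the monomial x_1^{α 0} ⋯ x_k^{α (k-1)} (other variables
-- to power 0) in X_H = Σ_κ ∏_v x_{κ(v)}: proper colourings κ using only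
-- colours in Fin k and with colour-class sizes α
coefX : {N : ℕ} → Graph N → (k : ℕ) → (Fin k → ℕ) → ℕ
coefX {N} H k α = count (λ κ → proper H κ ∧ hasContent α κ) (allVec N k)

-- coefficient of the same monomial in m_n = Σ_i x_i^n
coefM : ℕ → (k : ℕ) → (Fin k → ℕ) → ℕ
coefM n k α =
  count (λ c → all (λ d → α d ≡ᵇ (if d ==F c then n else 0)) (allFin k)) (allFin k)

-- index of the stable set containing vertex v (vertices of G_μ are
-- numbered 0,1,…, the first μ₁ form block 0, the next μ₂ block 1, …)
blockOf : List ℕ → ℕ → ℕ
blockOf []      v = 0
blockOf (p ∷ μ) v = if suc v ≤ᵇ p then 0 else suc (blockOf μ (v ∸ p))

Gμ : (μ : List ℕ) → Graph (sum μ)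
Gμ μ u v = not (blockOf μ (toℕ u) ≡ᵇ blockOf μ (toℕ v))

prodFac : List ℕ → ℕ
prodFac []       = 1
prodFac (x ∷ xs) = x ! * prodFac xs

prodFac-nz : ∀ xs → NonZero (prodFac xs)
prodFac-nz []       = _
prodFac-nz (x ∷ xs) = m*n≢0 (x !) (prodFac xs) {{x !≢0}} {{prodFac-nz xs}}

-- ∏_i μ_i! · ∏_{i=1}^{n} n_i(μ)!   (n_i(μ) = 0 for i > n contributes 0! = 1)
denomList : ℕ → List ℕ → List ℕ
denomList n μ = μ ++ map (λ i → mult i μ) (map suc (upTo n))

denom : ℕ → List ℕ → ℕ
denom n μ = prodFac (denomList n μ)

cμ : ℕ → List ℕ → ℚ
cμ n μ = (+ (n ! * (ℓ μ ∸ 1) !) / denom n μ) {{prodFac-nz (denomList n μ)}}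

signℚ : ℕ → ℚ
signℚ zero    = 1ℚ
signℚ (suc j) = - signℚ j

fromℕℚ : ℕ → ℚ
fromℕℚ m = + m / 1

sumℚ : List ℚ → ℚ
sumℚ = foldr _+ℚ_ 0ℚ

-- Cyclically ordered set partitions of [n] of type μ
--
-- An ordered set partition (S_0,…,S_{l-1}) of [n] is encoded by the block
-- assignment b : [n] → Fin l (b v = j iff v ∈ S_j).  A cyclic order of the
-- blocks is an ordered partition modulo rotation; since the blocks are
-- nonempty and disjoint, rotation acts freely, and each rotation class has
-- exactly one representative whose first block S_0 contains the element 1
-- of [n] (index 0 here).  We count these representatives.

blockSizes : {n l : ℕ} → Vec (Fin l) n → List ℕ
blockSizes {n} {l} b = map (λ j → count (λ v → lookup b v ==F j) (allFin n)) (allFin l)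

firstInBlock0 : {n l : ℕ} → Vec (Fin l) n → Bool
firstInBlock0 []      = true
firstInBlock0 (x ∷ _) = toℕ x ≡ᵇ 0

isCycOSPOfType : {n l : ℕ} → List ℕ → Vec (Fin l) n → Bool
isCycOSPOfType μ b =
  all (λ s → not (s ≡ᵇ 0)) (blockSizes b)
  ∧ multisetEq (blockSizes b) μ
  ∧ firstInBlock0 b                        -- rotation representative

cycCount : ℕ → List ℕ → ℕ
cycCount n μ = count (isCycOSPOfType μ) (allVec n (ℓ μ))

{-# OPTIONS --safe #-}
module Submission where

-- For the second claim, c_μ is a product of two multinomial counts: arrangements of
-- the parts of μ, and words with the block sizes so prescribed.
--
-- For the first claim, c_μ r_μ enumerates pairs (b , κ) of a cyclically ordered set
-- partition b of type μ and a colouring κ whose colour classes each lie in one block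
-- of b.  For fixed κ with t+1 colours, the signed number of such b is
-- Σ_l (-1)^(l-1) (l-1)! S(t+1, l), which is 1 for t = 0 and 0 otherwise, so only the
-- constant colourings survive, and these are the monomials of m_n.

open import Defs
open import Algebra.Structures using (IsCommutativeSemiring)
import Algebra.Properties.CommutativeSemigroup
open import Data.Bool using (Bool; true; false; _∧_; _∨_; not; if_then_else_; T)
open import Data.Bool.Properties using (T?; ∧-comm; ∧-zeroʳ; not-involutive; ∨-idem; ∨-identityʳ)
open import Data.Fin using (Fin; zero; suc; toℕ; fromℕ<; cast)
open import Data.Fin.Properties using (toℕ-injective; toℕ-fromℕ<; toℕ<n; cast-is-id; cast-trans)
import Data.Integer.Properties as ℤ
open import Data.Integer.Tactic.RingSolver using (solve-∀)
import Data.List as List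
open import Data.List using (List; []; _∷_; map; concatMap; filterᵇ; length; upTo; allFin; _++_; tabulate; applyUpTo; replicate)
open import Data.List.Membership.Propositional using (_∈_; _∉_; find)
open import Data.List.Membership.Propositional.Properties using (∈-allFin; ∈-map⁻; ∈-map⁺; ∈-++⁺ˡ; ∈-++⁺ʳ; ∈-∃++; ∈-concatMap⁻; ∈-filter⁺; ∈-filter⁻; ∈-upTo⁺; ∈-upTo⁻)
open import Data.List.Properties using (map-tabulate; tabulate-cong; map-applyUpTo; map-∘; map-id; map-cong-local; lookup-tabulate; length-tabulate; length-map)
import Data.List.Relation.Binary.Permutation.Homogeneous as Homogeneous
open import Data.List.Relation.Binary.Permutation.Propositional using (_↭_; ↭-sym; ↭-trans; prep; swap; ↭⇒↭ₛ) renaming (refl to ↭-refl; trans to ↭-trans′)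
open import Data.List.Relation.Binary.Permutation.Propositional.Properties using (shift; ∈-resp-↭; All-resp-↭; map⁺; ↭-length; ∷↭∷ʳ)
open import Data.List.Relation.Binary.Permutation.Setoid.Properties using (onIndices-lookup)
open import Data.List.Relation.Binary.Pointwise using (Pointwise-≡⇒≡)
open import Data.List.Relation.Unary.All as All using (All; []; _∷_)
open import Data.List.Relation.Unary.AllPairs using () renaming (_∷_ to _∷ᵖ_)
open import Data.List.Relation.Unary.Any using (here; there)
open import Data.List.Relation.Unary.Linked using (Linked; []; [-]; _∷_)
open import Data.List.Relation.Unary.Sorted.TotalOrder.Properties using (↗↭↗⇒≋)
open import Data.List.Relation.Unary.Unique.Propositional using (Unique)
import Data.List.Relation.Unary.Unique.Propositional.Properties as Unique
open import Data.List.Relation.Unary.Unique.Propositional.Properties using (allFin⁺; upTo⁺)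
import Data.List.Sort as Sort
import Data.Nat
open import Data.Nat as ℕ using (ℕ; zero; suc; _≡ᵇ_; _≤ᵇ_; _≤_; _<_; z≤n; s≤s; _∸_; _!)
open import Data.Nat.ListAction using (sum)
open import Data.Nat.ListAction.Properties using (sum-↭)
import Data.Nat.Properties as ℕ
import Data.Nat.Tactic.RingSolver as ℕSolver
open import Data.Product using (_×_; _,_; proj₁; proj₂; ∃; map₁)
open import Data.Rational as ℚ using (_/_)
import Data.Rational.Properties as ℚ
import Data.Rational.Unnormalised as ℚᵘ
import Data.Rational.Unnormalised.Properties as ℚᵘ
import Data.Vec as Vec
open import Data.Vec using (Vec; []; _∷_; lookup)
open import Function using (_∘_; id)
open import Function.Bundles using (Inverse)
open import Relation.Binary.Bundles using (DecTotalOrder)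
open import Relation.Binary.Construct.Flip.EqAndOrd using (decTotalOrder)
open import Relation.Binary.PropositionalEquality using (_≡_; _≢_; refl; sym; trans; cong; cong₂; subst; setoid; module ≡-Reasoning)
open import Relation.Nullary using (yes; no; contradiction)

-- The second claim feeds the first: once `c_μ` is known to be the integer `cycCount`, the expansion
-- is a signed count over ℤ, and rationals enter only at the end. Two obstacles shape that count.
-- The graph `G_μ` has `sum μ` numbered vertices, whereas the colourings paired with a set partition
-- `b` live on [n] and the blocks of `b` come in another order; colourings are therefore summed
-- along a list of vertex labels, a form insensitive to the order of the vertices. Secondly, a
-- recursion on t for Σ_l (-1)^(l-1) (l-1)! S(t+1, l) changes the number of blocks already hit. The
-- sum is therefore generalised to s blocks already hit, with weight (l-1)(l-2)⋯(l-s+1). The case s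
-- = 1 is the wanted one: the block of the element 1 is hit by the colour of that element, and
-- (l-1)! S(t+1, l) is the number of ways to send the other t colours to blocks so that the
-- remaining l-1 blocks are all hit.

module ℕ+ = Algebra.Properties.CommutativeSemigroup ℕ.+-commutativeSemigroup
module ℕ* = Algebra.Properties.CommutativeSemigroup ℕ.*-commutativeSemigroup
module ℤ* = Algebra.Properties.CommutativeSemigroup ℤ.*-commutativeSemigroup

-- Boolean tests and counting

≡-from-⇔ : ∀ {a b : Bool} → (a ≡ true → b ≡ true) → (b ≡ true → a ≡ true) → a ≡ b
≡-from-⇔ {false} {false} _ _ = refl
≡-from-⇔ {false} {true}  _ g = g refl
≡-from-⇔ {true}  {false} f _ = sym (f refl)
≡-from-⇔ {true}  {true}  _ _ = refl

∧-true⁻ : ∀ {a b} → a ∧ b ≡ true → a ≡ true × b ≡ true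
∧-true⁻ {true} {true} _ = refl , refl

∧-true⁺ : ∀ {a b} → a ≡ true → b ≡ true → a ∧ b ≡ true
∧-true⁺ refl refl = refl

≡ᵇ-sound : ∀ m n → (m ≡ᵇ n) ≡ true → m ≡ n
≡ᵇ-sound zero    zero    _ = refl
≡ᵇ-sound (suc m) (suc n) e = cong suc (≡ᵇ-sound m n e)

≡ᵇ-refl : ∀ n → (n ≡ᵇ n) ≡ true
≡ᵇ-refl zero    = refl
≡ᵇ-refl (suc n) = ≡ᵇ-refl n

≡ᵇ-complete : ∀ {m n} → m ≡ n → (m ≡ᵇ n) ≡ true
≡ᵇ-complete {m} refl = ≡ᵇ-refl m

≡ᵇ-false : ∀ {m n} → m ≢ n → (m ≡ᵇ n) ≡ false
≡ᵇ-false {m} {n} m≢n with m ≡ᵇ n in eq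
... | true  = contradiction (≡ᵇ-sound m n eq) m≢n
... | false = refl

≡ᵇ-sym : ∀ m n → (m ≡ᵇ n) ≡ (n ≡ᵇ m)
≡ᵇ-sym m n = ≡-from-⇔ (λ e → ≡ᵇ-complete (sym (≡ᵇ-sound m n e))) (λ e → ≡ᵇ-complete (sym (≡ᵇ-sound n m e)))

==F-sound : ∀ {k} {a b : Fin k} → (a ==F b) ≡ true → a ≡ b
==F-sound e = toℕ-injective (≡ᵇ-sound _ _ e)

==F-false : ∀ {k} {a b : Fin k} → a ≢ b → (a ==F b) ≡ false
==F-false a≢b = ≡ᵇ-false (a≢b ∘ toℕ-injective)

all-true⁻ : ∀ {A : Set} {p : A → Bool} {xs x} → all p xs ≡ true → x ∈ xs → p x ≡ true
all-true⁻ {xs = _ ∷ _} e (here refl) = proj₁ (∧-true⁻ e)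
all-true⁻ {xs = _ ∷ _} e (there x∈)  = all-true⁻ (proj₂ (∧-true⁻ e)) x∈

all-true⁺ : ∀ {A : Set} {p : A → Bool} xs → (∀ {x} → x ∈ xs → p x ≡ true) → all p xs ≡ true
all-true⁺ []       _ = refl
all-true⁺ (x ∷ xs) h = ∧-true⁺ (h (here refl)) (all-true⁺ xs (h ∘ there))

all-cong : ∀ {A : Set} {p q : A → Bool} → (∀ x → p x ≡ q x) → ∀ xs → all p xs ≡ all q xs
all-cong h []       = refl
all-cong h (x ∷ xs) = cong₂ _∧_ (h x) (all-cong h xs)

all-map : ∀ {A B : Set} (p : B → Bool) (f : A → B) xs → all p (map f xs) ≡ all (p ∘ f) xs
all-map p f []       = refl
all-map p f (x ∷ xs) = cong (p (f x) ∧_) (all-map p f xs)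

bit : Bool → ℕ
bit true  = 1
bit false = 0

count-∷ : ∀ {A : Set} (p : A → Bool) x xs → count p (x ∷ xs) ≡ bit (p x) ℕ.+ count p xs
count-∷ p x xs with p x
... | true  = refl
... | false = refl

count-cong : ∀ {A : Set} {p q : A → Bool} → (∀ x → p x ≡ q x) → ∀ xs → count p xs ≡ count q xs
count-cong h []       = refl
count-cong {p = p} {q} h (x ∷ xs) =
  trans (count-∷ p x xs) (trans (cong₂ ℕ._+_ (cong bit (h x)) (count-cong h xs)) (sym (count-∷ q x xs)))

count-map : ∀ {A B : Set} (p : B → Bool) (f : A → B) xs → count p (map f xs) ≡ count (p ∘ f) xs
count-map p f []       = refl
count-map p f (x ∷ xs) =
  trans (count-∷ p (f x) (map f xs)) (trans (cong (bit (p (f x)) ℕ.+_) (count-map p f xs)) (sym (count-∷ (p ∘ f) x xs)))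

count-++ : ∀ {A : Set} (p : A → Bool) xs ys → count p (xs ++ ys) ≡ count p xs ℕ.+ count p ys
count-++ p []       ys = refl
count-++ p (x ∷ xs) ys = begin
  count p (x ∷ xs ++ ys)                           ≡⟨ count-∷ p x (xs ++ ys) ⟩
  bit (p x) ℕ.+ count p (xs ++ ys)                 ≡⟨ cong (bit (p x) ℕ.+_) (count-++ p xs ys) ⟩
  bit (p x) ℕ.+ (count p xs ℕ.+ count p ys)        ≡⟨ ℕ.+-assoc (bit (p x)) _ _ ⟨
  bit (p x) ℕ.+ count p xs ℕ.+ count p ys          ≡⟨ cong (ℕ._+ count p ys) (count-∷ p x xs) ⟨
  count p (x ∷ xs) ℕ.+ count p ys                  ∎
  where open ≡-Reasoning

-- Finite sums in a commutative semiring

module Sum {C : Set} (_+_ _*_ : C → C → C) (0# 1# : C)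
           (isCSR : IsCommutativeSemiring _≡_ _+_ _*_ 0# 1#) where
  open IsCommutativeSemiring isCSR
    using (+-identityˡ; +-identityʳ; +-assoc; +-comm; *-comm; *-identityˡ; zeroˡ; zeroʳ; distribˡ)
  open ≡-Reasoning

  ∑ : {A : Set} → List A → (A → C) → C
  ∑ []       f = 0#
  ∑ (x ∷ xs) f = f x + ∑ xs f

  ⟦_⟧ : Bool → C
  ⟦ true ⟧  = 1#
  ⟦ false ⟧ = 0#

  ∑-cong∈ : ∀ {A : Set} {f g : A → C} xs → (∀ {x} → x ∈ xs → f x ≡ g x) → ∑ xs f ≡ ∑ xs g
  ∑-cong∈ []       h = refl
  ∑-cong∈ (x ∷ xs) h = cong₂ _+_ (h (here refl)) (∑-cong∈ xs (h ∘ there))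

  ∑-cong : ∀ {A : Set} {f g : A → C} xs → (∀ x → f x ≡ g x) → ∑ xs f ≡ ∑ xs g
  ∑-cong xs h = ∑-cong∈ xs (λ {x} _ → h x)

  ∑-0 : ∀ {A : Set} {f : A → C} xs → (∀ {x} → x ∈ xs → f x ≡ 0#) → ∑ xs f ≡ 0#
  ∑-0 []       h = refl
  ∑-0 (x ∷ xs) h = trans (cong₂ _+_ (h (here refl)) (∑-0 xs (h ∘ there))) (+-identityˡ 0#)

  +-exchange : ∀ a b c d → (a + b) + (c + d) ≡ (a + c) + (b + d)
  +-exchange a b c d = begin
    (a + b) + (c + d)  ≡⟨ +-assoc a b (c + d) ⟩
    a + (b + (c + d))  ≡⟨ cong (a +_) (+-assoc b c d) ⟨
    a + ((b + c) + d)  ≡⟨ cong (λ z → a + (z + d)) (+-comm b c) ⟩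
    a + ((c + b) + d)  ≡⟨ cong (a +_) (+-assoc c b d) ⟩
    a + (c + (b + d))  ≡⟨ +-assoc a c (b + d) ⟨
    (a + c) + (b + d)  ∎

  ∑-+ : ∀ {A : Set} (f g : A → C) xs → ∑ xs (λ x → f x + g x) ≡ ∑ xs f + ∑ xs g
  ∑-+ f g []       = sym (+-identityˡ 0#)
  ∑-+ f g (x ∷ xs) = trans (cong ((f x + g x) +_) (∑-+ f g xs)) (+-exchange (f x) (g x) (∑ xs f) (∑ xs g))

  ∑-*ˡ : ∀ {A : Set} a (f : A → C) xs → ∑ xs (λ x → a * f x) ≡ a * ∑ xs f
  ∑-*ˡ a f []       = sym (zeroʳ a)
  ∑-*ˡ a f (x ∷ xs) = trans (cong ((a * f x) +_) (∑-*ˡ a f xs)) (sym (distribˡ a (f x) (∑ xs f)))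

  ∑-*ʳ : ∀ {A : Set} a (f : A → C) xs → ∑ xs (λ x → f x * a) ≡ ∑ xs f * a
  ∑-*ʳ a f xs = trans (∑-cong xs (λ x → *-comm (f x) a)) (trans (∑-*ˡ a f xs) (*-comm a (∑ xs f)))

  ∑-swap : ∀ {A B : Set} (f : A → B → C) xs ys → ∑ xs (λ x → ∑ ys (f x)) ≡ ∑ ys (λ y → ∑ xs (λ x → f x y))
  ∑-swap f []       ys = sym (∑-0 ys (λ _ → refl))
  ∑-swap f (x ∷ xs) ys =
    trans (cong (∑ ys (f x) +_) (∑-swap f xs ys)) (sym (∑-+ (f x) (λ y → ∑ xs (λ x → f x y)) ys))

  ∑-++ : ∀ {A : Set} (f : A → C) xs ys → ∑ (xs ++ ys) f ≡ ∑ xs f + ∑ ys f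
  ∑-++ f []       ys = sym (+-identityˡ _)
  ∑-++ f (x ∷ xs) ys = trans (cong (f x +_) (∑-++ f xs ys)) (sym (+-assoc (f x) _ _))

  ∑-map : ∀ {A B : Set} (g : A → B) (f : B → C) xs → ∑ (map g xs) f ≡ ∑ xs (f ∘ g)
  ∑-map g f []       = refl
  ∑-map g f (x ∷ xs) = cong (f (g x) +_) (∑-map g f xs)

  ∑-concatMap : ∀ {A B : Set} (g : A → List B) (f : B → C) xs → ∑ (concatMap g xs) f ≡ ∑ xs (λ x → ∑ (g x) f)
  ∑-concatMap g f []       = refl
  ∑-concatMap g f (x ∷ xs) = trans (∑-++ f (g x) (concatMap g xs)) (cong (∑ (g x) f +_) (∑-concatMap g f xs))

  ∑-allVec : ∀ n k (f : Vec (Fin k) (suc n) → C) →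
             ∑ (allVec (suc n) k) f ≡ ∑ (allFin k) (λ c → ∑ (allVec n k) (λ b → f (c ∷ b)))
  ∑-allVec n k f =
    trans (∑-concatMap (λ c → map (c ∷_) (allVec n k)) f (allFin k))
          (∑-cong (allFin k) (λ c → ∑-map (c ∷_) f (allVec n k)))

  ∑-single : ∀ {A : Set} {f : A → C} {x xs} → Unique xs → x ∈ xs →
             (∀ {y} → y ∈ xs → y ≢ x → f y ≡ 0#) → ∑ xs f ≡ f x
  ∑-single {f = f} {x} {xs = _ ∷ xs} (x∉ ∷ᵖ u) (here refl) h =
    trans (cong (f x +_) (∑-0 xs (λ y∈ → h (there y∈) (λ { refl → All.lookup x∉ y∈ refl })))) (+-identityʳ (f x))
  ∑-single {f = f} {x} {xs = y ∷ xs} (y∉ ∷ᵖ u) (there x∈) h =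
    trans (cong₂ _+_ (h (here refl) (λ { refl → All.lookup y∉ x∈ refl })) (∑-single u x∈ (h ∘ there)))
          (+-identityˡ (f x))

  ∑-allFin-single : ∀ {k} {f : Fin k → C} x → (∀ y → y ≢ x → f y ≡ 0#) → ∑ (allFin k) f ≡ f x
  ∑-allFin-single {k} x h = ∑-single (allFin⁺ k) (∈-allFin x) (λ {y} _ → h y)

  ⟦∧⟧ : ∀ a b → ⟦ a ∧ b ⟧ ≡ ⟦ a ⟧ * ⟦ b ⟧
  ⟦∧⟧ true  b = sym (*-identityˡ ⟦ b ⟧)
  ⟦∧⟧ false b = sym (zeroˡ ⟦ b ⟧)

  ⟦⟧-*-cong : ∀ b {x y} → (b ≡ true → x ≡ y) → ⟦ b ⟧ * x ≡ ⟦ b ⟧ * y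
  ⟦⟧-*-cong true  h = cong (1# *_) (h refl)
  ⟦⟧-*-cong false h = trans (zeroˡ _) (sym (zeroˡ _))

open import Data.Integer as ℤ using (ℤ; +_)

-- ℕ carries the division-free counts behind `c_μ`, ℤ the signed sums of the expansion.
module ∑ℕ = Sum ℕ._+_ ℕ._*_ 0 1 ℕ.+-*-isCommutativeSemiring
module ∑ℤ = Sum ℤ._+_ ℤ._*_ (+ 0) (+ 1) ℤ.+-*-isCommutativeSemiring

count-∑ℕ : ∀ {A : Set} (p : A → Bool) xs → count p xs ≡ ∑ℕ.∑ xs (∑ℕ.⟦_⟧ ∘ p)
count-∑ℕ p []       = refl
count-∑ℕ p (x ∷ xs) with p x
... | true  = cong suc (count-∑ℕ p xs)
... | false = count-∑ℕ p xs

count-∑ℤ : ∀ {A : Set} (p : A → Bool) xs → + count p xs ≡ ∑ℤ.∑ xs (∑ℤ.⟦_⟧ ∘ p)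
count-∑ℤ p []       = refl
count-∑ℤ p (x ∷ xs) with p x
... | true  = trans (ℤ.pos-+ 1 (count p xs)) (cong (λ z → + 1 ℤ.+ z) (count-∑ℤ p xs))
... | false = trans (count-∑ℤ p xs) (sym (ℤ.+-identityˡ _))

-- Multisets and contents

count-↭ : ∀ {A : Set} (p : A → Bool) {xs ys} → xs ↭ ys → count p xs ≡ count p ys
count-↭ p ↭-refl = refl
count-↭ p (prep {xs} {ys} x r) =
  trans (count-∷ p x xs) (trans (cong (bit (p x) ℕ.+_) (count-↭ p r)) (sym (count-∷ p x ys)))
count-↭ p (swap {xs} {ys} x y r) = begin
  count p (x ∷ y ∷ xs)                          ≡⟨ count-∷ p x (y ∷ xs) ⟩
  bit (p x) ℕ.+ count p (y ∷ xs)                ≡⟨ cong (bit (p x) ℕ.+_) (count-∷ p y xs) ⟩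
  bit (p x) ℕ.+ (bit (p y) ℕ.+ count p xs)      ≡⟨ cong (λ z → bit (p x) ℕ.+ (bit (p y) ℕ.+ z)) (count-↭ p r) ⟩
  bit (p x) ℕ.+ (bit (p y) ℕ.+ count p ys)      ≡⟨ ℕ+.x∙yz≈y∙xz (bit (p x)) (bit (p y)) (count p ys) ⟩
  bit (p y) ℕ.+ (bit (p x) ℕ.+ count p ys)      ≡⟨ cong (bit (p y) ℕ.+_) (count-∷ p x ys) ⟨
  bit (p y) ℕ.+ count p (x ∷ ys)                ≡⟨ count-∷ p y (x ∷ ys) ⟨
  count p (y ∷ x ∷ ys)                          ∎
  where
  open ≡-Reasoning
count-↭ p (↭-trans′ r s) = trans (count-↭ p r) (count-↭ p s)

occ-here : ∀ x xs → occ x (x ∷ xs) ≡ suc (occ x xs)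
occ-here x xs = trans (count-∷ _ x xs) (cong (λ b → bit b ℕ.+ occ x xs) (≡ᵇ-refl x))

occ-∉ : ∀ {v} xs → v ∉ xs → occ v xs ≡ 0
occ-∉ []       _  = refl
occ-∉ {v} (x ∷ xs) v∉ =
  trans (count-∷ _ x xs)
        (cong₂ (λ b c → bit b ℕ.+ c) (≡ᵇ-false (v∉ ∘ here ∘ sym)) (occ-∉ xs (v∉ ∘ there)))

occ-∈ : ∀ {v m} xs → occ v xs ≡ suc m → v ∈ xs
occ-∈ {v} (x ∷ xs) e with x ≡ᵇ v in eq
... | true  = here (sym (≡ᵇ-sound x v eq))
... | false = there (occ-∈ xs e)

-- The head of `xs` has positive count in `ys`, so `ys` splits around it; removing it from both
-- sides keeps all counts equal.
occ⇒↭ : ∀ xs ys → (∀ v → occ v xs ≡ occ v ys) → xs ↭ ys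
occ⇒↭ []       []       h = ↭-refl
occ⇒↭ []       (y ∷ ys) h with trans (h y) (occ-here y ys)
... | ()
occ⇒↭ (x ∷ xs) ys h with ∈-∃++ (occ-∈ ys (trans (sym (h x)) (occ-here x xs)))
... | as , bs , refl = ↭-trans (prep x (occ⇒↭ xs (as ++ bs) rest)) (↭-sym (shift x as bs))
  where
  rest : ∀ v → occ v xs ≡ occ v (as ++ bs)
  rest v = ℕ.+-cancelˡ-≡ (bit (x ≡ᵇ v)) _ _
    (trans (sym (count-∷ _ x xs))
    (trans (h v)
    (trans (count-↭ _ (shift x as bs)) (count-∷ _ x (as ++ bs)))))

-- The test visits only the values of `xs ++ ys`; any other value occurs zero times in both lists.
multisetEq⇒↭ : ∀ {xs ys} → multisetEq xs ys ≡ true → xs ↭ ys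
multisetEq⇒↭ {xs} {ys} e = occ⇒↭ xs ys same
  where
  same : ∀ v → occ v xs ≡ occ v ys
  same v with occ v xs in ex | occ v ys in ey
  ... | zero  | zero  = refl
  ... | suc m | _     = trans (sym ex) (trans (≡ᵇ-sound _ _ (all-true⁻ e (∈-++⁺ˡ (occ-∈ xs ex)))) ey)
  ... | zero  | suc m = trans (sym ex) (trans (≡ᵇ-sound _ _ (all-true⁻ e (∈-++⁺ʳ xs (occ-∈ ys ey)))) ey)

↭⇒multisetEq : ∀ {xs ys} → xs ↭ ys → multisetEq xs ys ≡ true
↭⇒multisetEq {xs} {ys} r = all-true⁺ (xs ++ ys) (λ _ → ≡ᵇ-complete (count-↭ _ r))

prodFac-↭ : ∀ {xs ys} → xs ↭ ys → prodFac xs ≡ prodFac ys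
prodFac-↭ ↭-refl       = refl
prodFac-↭ (prep x r)   = cong (x ! ℕ.*_) (prodFac-↭ r)
prodFac-↭ (swap {ys = ys} x y r) =
  trans (cong (λ z → x ! ℕ.* (y ! ℕ.* z)) (prodFac-↭ r)) (ℕ*.x∙yz≈y∙xz (x !) (y !) (prodFac ys))
prodFac-↭ (↭-trans′ r s) = trans (prodFac-↭ r) (prodFac-↭ s)

prodFac-++ : ∀ xs ys → prodFac (xs ++ ys) ≡ prodFac xs ℕ.* prodFac ys
prodFac-++ []       ys = sym (ℕ.+-identityʳ _)
prodFac-++ (x ∷ xs) ys = trans (cong (x ! ℕ.*_) (prodFac-++ xs ys)) (sym (ℕ.*-assoc (x !) _ _))

allFin-suc : ∀ n → allFin (suc n) ≡ zero ∷ map suc (allFin n)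
allFin-suc n = cong (zero ∷_) (sym (map-tabulate id suc))

all-allFin-suc : ∀ {n} (p : Fin (suc n) → Bool) → all p (allFin (suc n)) ≡ p zero ∧ all (p ∘ suc) (allFin n)
all-allFin-suc {n} p = trans (cong (all p) (allFin-suc n)) (cong (p zero ∧_) (all-map p suc (allFin n)))

cnt : ∀ {n k} → Vec (Fin k) n → Fin k → ℕ
cnt {n} b j = count (λ v → lookup b v ==F j) (allFin n)

cnt-∷ : ∀ {n k} x (b : Vec (Fin k) n) j → cnt (x ∷ b) j ≡ bit (x ==F j) ℕ.+ cnt b j
cnt-∷ {n} x b j = begin
  count p (allFin (suc n))                          ≡⟨ cong (count p) (allFin-suc n) ⟩
  count p (zero ∷ map suc (allFin n))               ≡⟨ count-∷ p zero (map suc (allFin n)) ⟩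
  bit (x ==F j) ℕ.+ count p (map suc (allFin n))    ≡⟨ cong (bit (x ==F j) ℕ.+_) (count-map p suc (allFin n)) ⟩
  bit (x ==F j) ℕ.+ cnt b j                         ∎
  where
  open ≡-Reasoning
  p = λ v → lookup (x ∷ b) v ==F j

cnt≤n : ∀ {n k} (b : Vec (Fin k) n) j → cnt b j ≤ n
cnt≤n []      j = z≤n
cnt≤n (x ∷ b) j = ℕ.≤-trans (ℕ.≤-reflexive (cnt-∷ x b j)) (ℕ.+-mono-≤ (bit≤1 (x ==F j)) (cnt≤n b j))
  where
  bit≤1 : ∀ b → bit b ≤ 1
  bit≤1 true  = s≤s z≤n
  bit≤1 false = z≤n

hasContent⁻ : ∀ {n k} (α : Fin k → ℕ) (b : Vec (Fin k) n) → hasContent α b ≡ true → ∀ j → cnt b j ≡ α j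
hasContent⁻ α b e j = ≡ᵇ-sound _ _ (all-true⁻ e (∈-allFin j))

hasContent⁺ : ∀ {n k} (α : Fin k → ℕ) (b : Vec (Fin k) n) → (∀ j → cnt b j ≡ α j) → hasContent α b ≡ true
hasContent⁺ {k = k} α b h = all-true⁺ (allFin k) (λ {j} _ → ≡ᵇ-complete (h j))

-- A relation rather than the function `lower`, so that restriction to the tail is again an instance
-- and the lemmas below can recurse on `c`.
record Lowered {k} (c : Fin k) (α β : Fin k → ℕ) : Set where
  field
    at   : α c ≡ suc (β c)
    away : ∀ d → d ≢ c → α d ≡ β d

lowered-tail : ∀ {k} {c : Fin k} {α β} → Lowered (suc c) α β → Lowered c (α ∘ suc) (β ∘ suc)
lowered-tail L = record { at = at ; away = λ d d≢c → away (suc d) (λ { refl → d≢c refl }) }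
  where open Lowered L

sum-lowered : ∀ {k} {c : Fin k} {α β} → Lowered c α β → sum (tabulate α) ≡ suc (sum (tabulate β))
sum-lowered {c = zero}  L = cong₂ ℕ._+_ at (cong sum (tabulate-cong (λ d → away (suc d) (λ ()))))
  where open Lowered L
sum-lowered {c = suc c} {β = β} L =
  trans (cong₂ ℕ._+_ (away zero (λ ())) (sum-lowered (lowered-tail L))) (ℕ.+-suc (β zero) _)
  where open Lowered L

prodFac-lowered : ∀ {k} {c : Fin k} {α β} → Lowered c α β → prodFac (tabulate α) ≡ α c ℕ.* prodFac (tabulate β)
prodFac-lowered {c = zero} {α} {β} L = begin
  α zero ! ℕ.* prodFac (tabulate (α ∘ suc))
    ≡⟨ cong₂ (λ m xs → m ! ℕ.* prodFac xs) at (tabulate-cong (λ d → away (suc d) (λ ()))) ⟩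
  (suc (β zero) ℕ.* β zero !) ℕ.* prodFac (tabulate (β ∘ suc))
    ≡⟨ ℕ.*-assoc (suc (β zero)) (β zero !) _ ⟩
  suc (β zero) ℕ.* prodFac (tabulate β)
    ≡⟨ cong (ℕ._* prodFac (tabulate β)) at ⟨
  α zero ℕ.* prodFac (tabulate β) ∎
  where
  open Lowered L
  open ≡-Reasoning
prodFac-lowered {c = suc c} {α} {β} L =
  trans (cong₂ (λ m z → m ! ℕ.* z) (away zero (λ ())) (prodFac-lowered (lowered-tail L)))
        (ℕ*.x∙yz≈y∙xz (β zero !) (α (suc c)) _)
  where
  open Lowered L

-- At `α c = 0` the predecessor would leave 0; `lower-lowered` asks for a positive entry.
lower : ∀ {k} → Fin k → (Fin k → ℕ) → Fin k → ℕ
lower c α d = if d ==F c then ℕ.pred (α d) else α d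

lower-lowered : ∀ {k} {c : Fin k} {α m} → α c ≡ suc m → Lowered c α (lower c α)
lower-lowered {c = c} {α} {m} e = record { at = at ; away = away }
  where
  at : α c ≡ suc (lower c α c)
  at rewrite ≡ᵇ-refl (toℕ c) | e = refl
  away : ∀ d → d ≢ c → α d ≡ lower c α d
  away d d≢c rewrite ==F-false d≢c = refl

hasContent-∷ : ∀ {n k c} {α β : Fin k → ℕ} → Lowered c α β → (b : Vec (Fin k) n) →
               hasContent α (c ∷ b) ≡ hasContent β b
hasContent-∷ {c = c} {α} {β} L b = ≡-from-⇔ to from
  where
  open Lowered L
  bump : ∀ j → α j ≡ bit (c ==F j) ℕ.+ β j
  bump j with c ==F j in eq
  ... | true  rewrite sym (==F-sound {a = c} {b = j} eq) = at
  ... | false = away j (λ { refl → contradiction (trans (sym (≡ᵇ-refl (toℕ c))) eq) (λ ()) })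
  to : hasContent α (c ∷ b) ≡ true → hasContent β b ≡ true
  to e = hasContent⁺ β b (λ j → ℕ.+-cancelˡ-≡ (bit (c ==F j)) _ _
    (trans (sym (cnt-∷ c b j)) (trans (hasContent⁻ α (c ∷ b) e j) (bump j))))
  from : hasContent β b ≡ true → hasContent α (c ∷ b) ≡ true
  from e = hasContent⁺ α (c ∷ b) (λ j →
    trans (cnt-∷ c b j) (trans (cong (bit (c ==F j) ℕ.+_) (hasContent⁻ β b e j)) (sym (bump j))))

hasContent-absent : ∀ {n k} {c : Fin k} {α} → α c ≡ 0 → (b : Vec (Fin k) n) → hasContent α (c ∷ b) ≡ false
hasContent-absent {c = c} {α} e b with hasContent α (c ∷ b) in eq
... | false = refl
... | true with trans (sym (cnt-∷ c b c)) (trans (hasContent⁻ α (c ∷ b) eq c) e)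
...   | e′ rewrite ≡ᵇ-refl (toℕ c) with e′
...     | ()

-- Integer partitions

-- Follows the recursion of `ptnsAux`: each chosen part becomes the bound for the rest.
data Desc : ℕ → List ℕ → Set where
  []   : ∀ {m} → Desc m []
  step : ∀ {m k σ} → 1 ≤ k → k ≤ m → Desc k σ → Desc m (k ∷ σ)

firstParts : ℕ → ℕ → List ℕ
firstParts n m = filterᵇ (λ k → k ≤ᵇ m) (map suc (upTo n))

∈-firstParts⁺ : ∀ {k n m} → 1 ≤ k → k ≤ n → k ≤ m → k ∈ firstParts n m
∈-firstParts⁺ {suc k} {n} {m} _ k≤n k≤m =
  ∈-filter⁺ (T? ∘ (_≤ᵇ m)) (∈-map⁺ suc (∈-upTo⁺ k≤n)) (ℕ.≤⇒≤ᵇ k≤m)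

∈-firstParts⁻ : ∀ {k} n m → k ∈ firstParts n m → 1 ≤ k × k ≤ n × k ≤ m
∈-firstParts⁻ n m k∈ with ∈-filter⁻ (T? ∘ (_≤ᵇ m)) {xs = map suc (upTo n)} k∈
... | k∈′ , k≤m with ∈-map⁻ suc k∈′
...   | j , j∈ , refl = s≤s z≤n , ∈-upTo⁻ j∈ , ℕ.≤ᵇ⇒≤ _ _ k≤m

firstParts-unique : ∀ n m → Unique (firstParts n m)
firstParts-unique n m = Unique.filter⁺ (T? ∘ (_≤ᵇ m)) (Unique.map⁺ ℕ.suc-injective (upTo⁺ n))

ptnsAux-sound : ∀ f n m {μ} → μ ∈ ptnsAux f n m → Desc m μ × sum μ ≡ n
ptnsAux-sound f       zero    m (here refl) = [] , refl
ptnsAux-sound zero    (suc n) m ()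
ptnsAux-sound (suc f) (suc n) m μ∈
  with find (∈-concatMap⁻ (λ k → map (k ∷_) (ptnsAux f (suc n ∸ k) k)) {xs = firstParts (suc n) m} μ∈)
... | k , k∈ , μ∈′ with ∈-firstParts⁻ (suc n) m k∈ | ∈-map⁻ (k ∷_) μ∈′
...   | 1≤k , k≤n , k≤m | μ′ , μ′∈ , refl with ptnsAux-sound f (suc n ∸ k) k μ′∈
...     | d , e = step 1≤k k≤m d , trans (cong (k ℕ.+_) e) (ℕ.m+[n∸m]≡n k≤n)

All≤sum : ∀ σ → All (_≤ sum σ) σ
All≤sum []      = []
All≤sum (x ∷ σ) = ℕ.m≤m+n x (sum σ) ∷ All.map (λ y≤ → ℕ.≤-trans y≤ (ℕ.m≤n+m (sum σ) x)) (All≤sum σ)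

-- The coefficients c_μ

module _ where
  open ∑ℕ

  ∑-allFin : ∀ k (f : Fin k → ℕ) → ∑ (allFin k) f ≡ sum (tabulate f)
  ∑-allFin zero    f = refl
  ∑-allFin (suc k) f = cong (f zero ℕ.+_) (trans (trans (cong (λ xs → ∑ xs f) (sym (map-tabulate id suc)))
    (∑-map suc f (allFin k))) (∑-allFin k (f ∘ suc)))

  sum≡0⇒≡0 : ∀ {k} (α : Fin k → ℕ) → sum (tabulate α) ≡ 0 → ∀ j → α j ≡ 0
  sum≡0⇒≡0 α e zero    = ℕ.m+n≡0⇒m≡0 (α zero) e
  sum≡0⇒≡0 α e (suc j) = sum≡0⇒≡0 (α ∘ suc) (ℕ.m+n≡0⇒n≡0 (α zero) e) j

  sum≡0⇒prodFac≡1 : ∀ {k} (α : Fin k → ℕ) → sum (tabulate α) ≡ 0 → prodFac (tabulate α) ≡ 1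
  sum≡0⇒prodFac≡1 {zero}  α e = refl
  sum≡0⇒prodFac≡1 {suc k} α e =
    cong₂ (λ m p → m ! ℕ.* p) (sum≡0⇒≡0 α e zero) (sum≡0⇒prodFac≡1 (α ∘ suc) (ℕ.m+n≡0⇒n≡0 (α zero) e))

  -- Splitting words by their first letter `c` gives Σ_c α_c · n! = (n+1)!. Multiplying by the
  -- factorials instead of dividing keeps everything in ℕ.
  multinomial : ∀ n k (α : Fin k → ℕ) → sum (tabulate α) ≡ n →
                ∑ (allVec n k) (λ b → ⟦ hasContent α b ⟧) ℕ.* prodFac (tabulate α) ≡ n !

  -- Besides driving the induction, this refinement by first letter is what counts the words rooted
  -- in block 0 and the arrangements with a given first part.
  multinomial-∷ : ∀ n k (α : Fin k → ℕ) c → sum (tabulate α) ≡ suc n →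
                  ∑ (allVec n k) (λ b → ⟦ hasContent α (c ∷ b) ⟧) ℕ.* prodFac (tabulate α) ≡ α c ℕ.* n !

  multinomial zero k α e = cong₂ (λ b p → (⟦ b ⟧ ℕ.+ 0) ℕ.* p)
    (hasContent⁺ α [] (λ j → sym (sum≡0⇒≡0 α e j))) (sum≡0⇒prodFac≡1 α e)
  multinomial (suc n) k α e = begin
    ∑ (allVec (suc n) k) (λ b → ⟦ hasContent α b ⟧) ℕ.* P
      ≡⟨ cong (ℕ._* P) (∑-allVec n k _) ⟩
    ∑ (allFin k) (λ c → ∑ (allVec n k) (λ b → ⟦ hasContent α (c ∷ b) ⟧)) ℕ.* P
      ≡⟨ ∑-*ʳ P _ (allFin k) ⟨
    ∑ (allFin k) (λ c → ∑ (allVec n k) (λ b → ⟦ hasContent α (c ∷ b) ⟧) ℕ.* P)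
      ≡⟨ ∑-cong (allFin k) (λ c → multinomial-∷ n k α c e) ⟩
    ∑ (allFin k) (λ c → α c ℕ.* n !)
      ≡⟨ ∑-*ʳ (n !) α (allFin k) ⟩
    ∑ (allFin k) α ℕ.* n !
      ≡⟨ cong (ℕ._* n !) (trans (∑-allFin k α) e) ⟩
    suc n ! ∎
    where
    open ≡-Reasoning
    P = prodFac (tabulate α)

  multinomial-∷ n k α c e with α c in αc
  ... | zero  = cong (ℕ._* prodFac (tabulate α)) (∑-0 (allVec n k) (λ {b} _ → cong ⟦_⟧ (hasContent-absent {c = c} {α = α} αc b)))
  ... | suc m = begin
    ∑ (allVec n k) (λ b → ⟦ hasContent α (c ∷ b) ⟧) ℕ.* prodFac (tabulate α)
      ≡⟨ cong₂ ℕ._*_ (∑-cong (allVec n k) (λ b → cong ⟦_⟧ (hasContent-∷ L b))) (prodFac-lowered L) ⟩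
    ∑ (allVec n k) (λ b → ⟦ hasContent β b ⟧) ℕ.* (α c ℕ.* prodFac (tabulate β))
      ≡⟨ ℕ*.x∙yz≈y∙xz (∑ (allVec n k) (λ b → ⟦ hasContent β b ⟧)) (α c) _ ⟩
    α c ℕ.* (∑ (allVec n k) (λ b → ⟦ hasContent β b ⟧) ℕ.* prodFac (tabulate β))
      ≡⟨ cong₂ ℕ._*_ αc (multinomial n k β (ℕ.suc-injective (trans (sym (sum-lowered L)) e))) ⟩
    suc m ℕ.* n ! ∎
    where
    open ≡-Reasoning
    β = lower c α
    L : Lowered c α β
    L = lower-lowered αc

  -- A delta function on vectors, used to regroup words by their block sizes. For `s = cnt b` the
  -- indicator is `hasContent (toℕ ∘ lookup a) b` by definition.
  ∑-match : ∀ l m (s : Fin l → ℕ) → (∀ j → s j < m) → (g : Vec (Fin m) l → ℕ) →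
            ∃ λ a → (∀ j → toℕ (lookup a j) ≡ s j) ×
                    ∑ (allVec l m) (λ a → ⟦ all (λ j → s j ≡ᵇ toℕ (lookup a j)) (allFin l) ⟧ ℕ.* g a) ≡ g a
  ∑-match zero    m s s<m g = [] , (λ ()) , trans (ℕ.+-identityʳ _) (ℕ.*-identityˡ (g []))
  ∑-match (suc l) m s s<m g with ∑-match l m (s ∘ suc) (s<m ∘ suc) (g ∘ (fromℕ< (s<m zero) ∷_))
  ... | a , a≡s , e = i ∷ a , (λ { zero → toℕ-fromℕ< (s<m zero) ; (suc j) → a≡s j }) , (begin
    ∑ (allVec (suc l) m) (λ a → ⟦ match s a ⟧ ℕ.* g a)
      ≡⟨ ∑-allVec l m _ ⟩
    ∑ (allFin m) (λ c → ∑ (allVec l m) (λ a → ⟦ match s (c ∷ a) ⟧ ℕ.* g (c ∷ a)))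
      ≡⟨ ∑-cong (allFin m) (λ c → ∑-cong (allVec l m) (λ a →
           cong (λ b → ⟦ b ⟧ ℕ.* g (c ∷ a)) (all-allFin-suc (λ j → s j ≡ᵇ toℕ (lookup (c ∷ a) j))))) ⟩
    ∑ (allFin m) (λ c → ∑ (allVec l m) (λ a → ⟦ (s zero ≡ᵇ toℕ c) ∧ match (s ∘ suc) a ⟧ ℕ.* g (c ∷ a)))
      ≡⟨ ∑-allFin-single i (λ c c≢i → ∑-0 (allVec l m) (λ {a} _ →
           cong (λ b → ⟦ b ∧ match (s ∘ suc) a ⟧ ℕ.* g (c ∷ a))
             (≡ᵇ-false (λ s≡c → c≢i (toℕ-injective (trans (sym s≡c) (sym (toℕ-fromℕ< (s<m zero))))))))) ⟩
    ∑ (allVec l m) (λ a → ⟦ (s zero ≡ᵇ toℕ i) ∧ match (s ∘ suc) a ⟧ ℕ.* g (i ∷ a))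
      ≡⟨ ∑-cong (allVec l m) (λ a → cong (λ b → ⟦ b ∧ match (s ∘ suc) a ⟧ ℕ.* g (i ∷ a))
           (≡ᵇ-complete (sym (toℕ-fromℕ< (s<m zero))))) ⟩
    ∑ (allVec l m) (λ a → ⟦ match (s ∘ suc) a ⟧ ℕ.* g (i ∷ a))
      ≡⟨ e ⟩
    g (i ∷ a) ∎)
    where
    open ≡-Reasoning
    i = fromℕ< (s<m zero)
    match : ∀ {l} → (Fin l → ℕ) → Vec (Fin m) l → Bool
    match s a = all (λ j → s j ≡ᵇ toℕ (lookup a j)) (allFin _)

  values : ∀ {l m} → Vec (Fin m) l → List ℕ
  values a = tabulate (toℕ ∘ lookup a)

  occ-values : ∀ {l m} (a : Vec (Fin m) l) i → occ (toℕ i) (values a) ≡ cnt a i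
  occ-values []      i = refl
  occ-values (x ∷ a) i =
    trans (count-∷ _ (toℕ x) (values a))
          (trans (cong (bit (x ==F i) ℕ.+_) (occ-values a i)) (sym (cnt-∷ x a i)))

  ∉-values : ∀ {l m v} (a : Vec (Fin m) l) → m ≤ v → v ∉ values a
  ∉-values (x ∷ a) m≤v (here refl) = ℕ.<⇒≱ (toℕ<n x) m≤v
  ∉-values (x ∷ a) m≤v (there v∈)  = ∉-values a m≤v v∈

  All<⇒∉ : ∀ {m v μ} → All (_< m) μ → m ≤ v → v ∉ μ
  All<⇒∉ μ<m m≤v v∈ = ℕ.<⇒≱ (All.lookup μ<m v∈) m≤v

  -- An arrangement of the parts of `μ` is itself a word, over the alphabet of part sizes, with the
  -- multiplicities of `μ` as content. Thus one multinomial count serves both for arrangements and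
  -- for block assignments. Values from `m` on occur in neither list.
  hasContent⇒↭ : ∀ {l m μ} (a : Vec (Fin m) l) → All (_< m) μ →
                 hasContent (λ i → occ (toℕ i) μ) a ≡ true → values a ↭ μ
  hasContent⇒↭ {m = m} {μ} a μ<m e = occ⇒↭ (values a) μ same
    where
    same : ∀ v → occ v (values a) ≡ occ v μ
    same v with v ℕ.<? m
    ... | yes v<m = begin
      occ v (values a)                   ≡⟨ cong (λ w → occ w (values a)) (toℕ-fromℕ< v<m) ⟨
      occ (toℕ (fromℕ< v<m)) (values a)  ≡⟨ occ-values a (fromℕ< v<m) ⟩
      cnt a (fromℕ< v<m)                 ≡⟨ hasContent⁻ _ a e (fromℕ< v<m) ⟩
      occ (toℕ (fromℕ< v<m)) μ           ≡⟨ cong (λ w → occ w μ) (toℕ-fromℕ< v<m) ⟩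
      occ v μ                            ∎
      where open ≡-Reasoning
    ... | no v≮m = trans (occ-∉ (values a) (∉-values a (ℕ.≮⇒≥ v≮m))) (sym (occ-∉ μ (All<⇒∉ μ<m (ℕ.≮⇒≥ v≮m))))

  ↭⇒hasContent : ∀ {l m μ} (a : Vec (Fin m) l) → values a ↭ μ → hasContent (λ i → occ (toℕ i) μ) a ≡ true
  ↭⇒hasContent a r = hasContent⁺ _ a (λ i → trans (sym (occ-values a i)) (count-↭ _ r))

  blockSizes≡ : ∀ {n l} (b : Vec (Fin l) n) → blockSizes b ≡ tabulate (cnt b)
  blockSizes≡ b = map-tabulate id (cnt b)

  positive⇒nonempty : ∀ {xs} → All (1 ≤_) xs → all (λ s → not (s ≡ᵇ 0)) xs ≡ true
  positive⇒nonempty []               = refl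
  positive⇒nonempty (s≤s z≤n ∷ pos)  = positive⇒nonempty pos

  -- With `w = id` this gives Σ i·n_i(μ) = |μ|, with `w` constantly 1 it gives Σ n_i(μ) = l(μ).
  ∑-*occ : ∀ m (w : ℕ → ℕ) {μ} → All (_< m) μ → ∑ (allFin m) (λ i → w (toℕ i) ℕ.* occ (toℕ i) μ) ≡ sum (map w μ)
  ∑-*occ m w []                  = ∑-0 (allFin m) (λ {i} _ → ℕ.*-zeroʳ (w (toℕ i)))
  ∑-*occ m w {x ∷ μ} (x<m ∷ μ<m) = begin
    ∑ (allFin m) (λ i → w (toℕ i) ℕ.* occ (toℕ i) (x ∷ μ))
      ≡⟨ ∑-cong (allFin m) (λ i → trans (cong (w (toℕ i) ℕ.*_) (count-∷ _ x μ)) (ℕ.*-distribˡ-+ (w (toℕ i)) _ _)) ⟩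
    ∑ (allFin m) (λ i → w (toℕ i) ℕ.* bit (x ≡ᵇ toℕ i) ℕ.+ w (toℕ i) ℕ.* occ (toℕ i) μ)
      ≡⟨ ∑-+ _ _ (allFin m) ⟩
    ∑ (allFin m) (λ i → w (toℕ i) ℕ.* bit (x ≡ᵇ toℕ i)) ℕ.+ ∑ (allFin m) (λ i → w (toℕ i) ℕ.* occ (toℕ i) μ)
      ≡⟨ cong₂ ℕ._+_ (trans (∑-allFin-single (fromℕ< x<m) other) this) (∑-*occ m w μ<m) ⟩
    w x ℕ.+ sum (map w μ) ∎
    where
    open ≡-Reasoning
    other : ∀ i → i ≢ fromℕ< x<m → w (toℕ i) ℕ.* bit (x ≡ᵇ toℕ i) ≡ 0
    other i i≢ = trans (cong (λ b → w (toℕ i) ℕ.* bit b)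
      (≡ᵇ-false (λ x≡i → i≢ (toℕ-injective (trans (sym x≡i) (sym (toℕ-fromℕ< x<m)))))))
      (ℕ.*-zeroʳ (w (toℕ i)))
    this : w (toℕ (fromℕ< x<m)) ℕ.* bit (x ≡ᵇ toℕ (fromℕ< x<m)) ≡ w x
    this rewrite toℕ-fromℕ< x<m | ≡ᵇ-refl x = ℕ.*-identityʳ (w x)

  sum-map-1 : ∀ (xs : List ℕ) → sum (map (λ _ → 1) xs) ≡ length xs
  sum-map-1 []       = refl
  sum-map-1 (x ∷ xs) = cong suc (sum-map-1 xs)

  tabulate-toℕ : ∀ {A : Set} n (f : ℕ → A) → tabulate {n = n} (f ∘ toℕ) ≡ applyUpTo f n
  tabulate-toℕ zero    f = refl
  tabulate-toℕ (suc n) f = cong (f 0 ∷_) (tabulate-toℕ n (f ∘ suc))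

  -- The alphabet of sizes starts at 0 while `denom` starts at 1; `μ` has no part 0, so the extra
  -- factor is 0! = 1.
  denom≡ : ∀ n μ → All (1 ≤_) μ →
           denom n μ ≡ prodFac μ ℕ.* prodFac (tabulate {n = suc n} (λ i → occ (toℕ i) μ))
  denom≡ n μ pos = begin
    denom n μ
      ≡⟨ prodFac-++ μ _ ⟩
    prodFac μ ℕ.* prodFac (map (λ i → occ i μ) (map suc (upTo n)))
      ≡⟨ cong (λ xs → prodFac μ ℕ.* prodFac xs)
           (trans (sym (map-∘ (upTo n))) (trans (map-applyUpTo id (λ i → occ (suc i) μ) n) (sym (tabulate-toℕ n (λ i → occ (suc i) μ))))) ⟩
    prodFac μ ℕ.* prodFac (tabulate {n = n} (λ i → occ (suc (toℕ i)) μ))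
      ≡⟨ cong (prodFac μ ℕ.*_) (ℕ.*-identityˡ _) ⟨
    prodFac μ ℕ.* (1 ℕ.* prodFac (tabulate {n = n} (λ i → occ (suc (toℕ i)) μ)))
      ≡⟨ cong (λ m → prodFac μ ℕ.* (m ! ℕ.* prodFac (tabulate {n = n} (λ i → occ (suc (toℕ i)) μ))))
           (occ-∉ μ (λ 0∈ → ℕ.<-irrefl refl (All.lookup pos 0∈))) ⟨
    prodFac μ ℕ.* prodFac (tabulate {n = suc n} (λ i → occ (toℕ i) μ)) ∎
    where open ≡-Reasoning

  -- Words b are grouped by their vector a of block sizes.  Fixing first letters, the
  -- words over a contribute n!·a₀ and the arrangements a with a₀ = i contribute
  -- (l-1)!·n_i(μ), both up to the denominators, and Σ i·n_i(μ) = n+1.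
  cycCount*denom : ∀ n μ → sum μ ≡ suc n → All (1 ≤_) μ →
                   cycCount (suc n) μ ℕ.* denom (suc n) μ ≡ suc n ! ℕ.* (ℓ μ ∸ 1) !
  cycCount*denom n []       () pos
  cycCount*denom n μ@(p ∷ μ′) e pos = begin
    cycCount (suc n) μ ℕ.* denom (suc n) μ
      ≡⟨ cong₂ ℕ._*_ grouped (denom≡ (suc n) μ pos) ⟩
    ∑ (allVec l m) (λ a → ⟦ arr a ⟧ ℕ.* words a) ℕ.* (prodFac μ ℕ.* M)
      ≡⟨ ℕ.*-assoc (∑ (allVec l m) (λ a → ⟦ arr a ⟧ ℕ.* words a)) (prodFac μ) M ⟨
    ∑ (allVec l m) (λ a → ⟦ arr a ⟧ ℕ.* words a) ℕ.* prodFac μ ℕ.* M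
      ≡⟨ cong (ℕ._* M) (∑-*ʳ (prodFac μ) _ (allVec l m)) ⟨
    ∑ (allVec l m) (λ a → ⟦ arr a ⟧ ℕ.* words a ℕ.* prodFac μ) ℕ.* M
      ≡⟨ cong (ℕ._* M) (∑-cong (allVec l m) (λ a → trans (ℕ.*-assoc ⟦ arr a ⟧ (words a) (prodFac μ))
           (⟦⟧-*-cong (arr a) (words-count a)))) ⟩
    ∑ (allVec l m) (λ a → ⟦ arr a ⟧ ℕ.* (toℕ (lookup a zero) ℕ.* n !)) ℕ.* M
      ≡⟨ cong (ℕ._* M) (∑-allVec l′ m _) ⟩
    ∑ (allFin m) (λ i → ∑ (allVec l′ m) (λ a → ⟦ arr (i ∷ a) ⟧ ℕ.* (toℕ i ℕ.* n !))) ℕ.* M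
      ≡⟨ ∑-*ʳ M (λ i → ∑ (allVec l′ m) (λ a → ⟦ arr (i ∷ a) ⟧ ℕ.* (toℕ i ℕ.* n !))) (allFin m) ⟨
    ∑ (allFin m) (λ i → ∑ (allVec l′ m) (λ a → ⟦ arr (i ∷ a) ⟧ ℕ.* (toℕ i ℕ.* n !)) ℕ.* M)
      ≡⟨ ∑-cong (allFin m) arrangements-count ⟩
    ∑ (allFin m) (λ i → toℕ i ℕ.* occ (toℕ i) μ ℕ.* (n ! ℕ.* l′ !))
      ≡⟨ ∑-*ʳ (n ! ℕ.* l′ !) (λ i → toℕ i ℕ.* occ (toℕ i) μ) (allFin m) ⟩
    ∑ (allFin m) (λ i → toℕ i ℕ.* occ (toℕ i) μ) ℕ.* (n ! ℕ.* l′ !)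
      ≡⟨ cong (ℕ._* (n ! ℕ.* l′ !)) (trans (∑-*occ m id μ<m) (trans (cong sum (map-id μ)) e)) ⟩
    suc n ℕ.* (n ! ℕ.* l′ !)
      ≡⟨ ℕ.*-assoc (suc n) (n !) (l′ !) ⟨
    suc n ! ℕ.* l′ ! ∎
    where
    open ≡-Reasoning
    l′ = length μ′
    l  = suc l′
    -- Block sizes range over 0, ..., n+1, hence n+2 letters.
    m  = suc (suc n)
    μ<m : All (_< m) μ
    μ<m = All.map (λ x≤ → s≤s (ℕ.≤-trans x≤ (ℕ.≤-reflexive e))) (All≤sum μ)
    mults : Fin m → ℕ
    mults i = occ (toℕ i) μ
    M = prodFac (tabulate mults)
    arr : Vec (Fin m) l → Bool
    arr = hasContent mults
    words : Vec (Fin m) l → ℕ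
    words a = ∑ (allVec (suc n) l) (λ b → ⟦ hasContent (toℕ ∘ lookup a) b ⟧ ℕ.* ⟦ firstInBlock0 b ⟧)

    -- Under the hypothesis `values a` is the list of block sizes of `b`. Nonemptiness of the blocks
    -- then comes from the positivity of the parts of `μ`.
    same-type : ∀ (b : Vec (Fin l) (suc n)) a → (∀ j → toℕ (lookup a j) ≡ cnt b j) →
                arr a ∧ firstInBlock0 b ≡ isCycOSPOfType μ b
    same-type b a a≡ = ≡-from-⇔
      (λ h → let (x , y) = ∧-true⁻ h ; r = subst (_↭ μ) val (hasContent⇒↭ a μ<m x) in
         ∧-true⁺ (positive⇒nonempty (All-resp-↭ (↭-sym r) pos)) (∧-true⁺ (↭⇒multisetEq r) y))
      (λ h → let (x , y) = ∧-true⁻ (proj₂ (∧-true⁻ {all (λ s → not (s ≡ᵇ 0)) (blockSizes b)} h)) in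
         ∧-true⁺ (↭⇒hasContent a (subst (_↭ μ) (sym val) (multisetEq⇒↭ x))) y)
      where
      val : values a ≡ blockSizes b
      val = trans (tabulate-cong a≡) (sym (blockSizes≡ b))

    grouped : cycCount (suc n) μ ≡ ∑ (allVec l m) (λ a → ⟦ arr a ⟧ ℕ.* words a)
    grouped = begin
      cycCount (suc n) μ
        ≡⟨ count-∑ℕ (isCycOSPOfType μ) (allVec (suc n) l) ⟩
      ∑ (allVec (suc n) l) (λ b → ⟦ isCycOSPOfType μ b ⟧)
        ≡⟨ ∑-cong (allVec (suc n) l) (λ b → let (a , a≡ , eq) = ∑-match l m (cnt b) (λ j → s≤s (cnt≤n b j)) (λ a → ⟦ arr a ∧ firstInBlock0 b ⟧) in
             trans (cong ⟦_⟧ (sym (same-type b a a≡))) (sym eq)) ⟩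
      ∑ (allVec (suc n) l) (λ b → ∑ (allVec l m) (λ a → ⟦ hasContent (toℕ ∘ lookup a) b ⟧ ℕ.* ⟦ arr a ∧ firstInBlock0 b ⟧))
        ≡⟨ ∑-swap _ (allVec (suc n) l) (allVec l m) ⟩
      ∑ (allVec l m) (λ a → ∑ (allVec (suc n) l) (λ b → ⟦ hasContent (toℕ ∘ lookup a) b ⟧ ℕ.* ⟦ arr a ∧ firstInBlock0 b ⟧))
        ≡⟨ ∑-cong (allVec l m) (λ a → trans
             (∑-cong (allVec (suc n) l) (λ b → trans (cong (⟦ hasContent (toℕ ∘ lookup a) b ⟧ ℕ.*_) (⟦∧⟧ (arr a) (firstInBlock0 b)))
               (ℕ*.x∙yz≈y∙xz ⟦ hasContent (toℕ ∘ lookup a) b ⟧ ⟦ arr a ⟧ ⟦ firstInBlock0 b ⟧)))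
             (∑-*ˡ ⟦ arr a ⟧ _ (allVec (suc n) l))) ⟩
      ∑ (allVec l m) (λ a → ⟦ arr a ⟧ ℕ.* words a) ∎

    -- The root condition leaves only first letter 0, so the refined multinomial count applies, with
    -- `values a ↭ μ` identifying the factorials.
    words-count : ∀ a → arr a ≡ true → words a ℕ.* prodFac μ ≡ toℕ (lookup a zero) ℕ.* n !
    words-count a h = begin
      words a ℕ.* prodFac μ
        ≡⟨ cong₂ ℕ._*_ first (prodFac-↭ (↭-sym r)) ⟩
      ∑ (allVec n l) (λ b → ⟦ hasContent (toℕ ∘ lookup a) (zero ∷ b) ⟧) ℕ.* prodFac (values a)
        ≡⟨ multinomial-∷ n l (toℕ ∘ lookup a) zero (trans (sum-↭ r) e) ⟩
      toℕ (lookup a zero) ℕ.* n ! ∎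
      where
      r : values a ↭ μ
      r = hasContent⇒↭ a μ<m h
      first : words a ≡ ∑ (allVec n l) (λ b → ⟦ hasContent (toℕ ∘ lookup a) (zero ∷ b) ⟧)
      first = trans (∑-allVec n l _) (trans
        (∑-allFin-single zero (λ { zero 0≢0 → contradiction refl 0≢0
                                 ; (suc c) _ → ∑-0 (allVec n l) (λ {b} _ → ℕ.*-zeroʳ ⟦ hasContent (toℕ ∘ lookup a) (suc c ∷ b) ⟧) }))
        (∑-cong (allVec n l) (λ b → ℕ.*-identityʳ _)))

    sum-mults : sum (tabulate mults) ≡ l
    sum-mults = begin
      sum (tabulate mults)                 ≡⟨ ∑-allFin m mults ⟨
      ∑ (allFin m) mults                   ≡⟨ ∑-cong (allFin m) (λ i → ℕ.*-identityˡ (mults i)) ⟨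
      ∑ (allFin m) (λ i → 1 ℕ.* mults i)   ≡⟨ ∑-*occ m (λ _ → 1) μ<m ⟩
      sum (map (λ _ → 1) μ)                ≡⟨ sum-map-1 μ ⟩
      l                                    ∎

    arrangements-count : ∀ i → ∑ (allVec l′ m) (λ a → ⟦ arr (i ∷ a) ⟧ ℕ.* (toℕ i ℕ.* n !)) ℕ.* M
                               ≡ toℕ i ℕ.* occ (toℕ i) μ ℕ.* (n ! ℕ.* l′ !)
    arrangements-count i = begin
      ∑ (allVec l′ m) (λ a → ⟦ arr (i ∷ a) ⟧ ℕ.* (toℕ i ℕ.* n !)) ℕ.* M
        ≡⟨ cong (ℕ._* M) (∑-*ʳ (toℕ i ℕ.* n !) _ (allVec l′ m)) ⟩
      ∑ (allVec l′ m) (λ a → ⟦ arr (i ∷ a) ⟧) ℕ.* (toℕ i ℕ.* n !) ℕ.* M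
        ≡⟨ rearrange (∑ (allVec l′ m) (λ a → ⟦ arr (i ∷ a) ⟧)) (toℕ i) (n !) M ⟩
      ∑ (allVec l′ m) (λ a → ⟦ arr (i ∷ a) ⟧) ℕ.* M ℕ.* (toℕ i ℕ.* n !)
        ≡⟨ cong (ℕ._* (toℕ i ℕ.* n !)) (multinomial-∷ l′ m mults i sum-mults) ⟩
      mults i ℕ.* l′ ! ℕ.* (toℕ i ℕ.* n !)
        ≡⟨ rearrange′ (mults i) (l′ !) (toℕ i) (n !) ⟩
      toℕ i ℕ.* occ (toℕ i) μ ℕ.* (n ! ℕ.* l′ !) ∎
      where
      rearrange : ∀ a b c d → a ℕ.* (b ℕ.* c) ℕ.* d ≡ a ℕ.* d ℕ.* (b ℕ.* c)
      rearrange = ℕSolver.solve-∀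
      rearrange′ : ∀ a b c d → a ℕ.* b ℕ.* (c ℕ.* d) ≡ c ℕ.* a ℕ.* (d ℕ.* b)
      rearrange′ = ℕSolver.solve-∀

-- Sums over the list of partitions

open ∑ℤ

-- Expresses at once that `σ` is listed and that it is listed only once. The outer sum over first
-- parts collapses to the head of `σ`, and the tail follows by induction.
∑-ptnsAux-single : ∀ f n m {σ} (g : List ℕ → ℤ) → n ≤ f → Desc m σ → sum σ ≡ n →
                   (∀ {μ} → Desc m μ → μ ≢ σ → g μ ≡ + 0) → ∑ (ptnsAux f n m) g ≡ g σ
∑-ptnsAux-single f zero m g _ [] e h = ℤ.+-identityʳ (g [])
∑-ptnsAux-single f zero m g _ (step {k = suc k} 1≤k k≤m d) () h
∑-ptnsAux-single (suc f) (suc n) m {k ∷ σ} g (s≤s n≤f) (step 1≤k k≤m d) e h = begin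
  ∑ (ptnsAux (suc f) (suc n) m) g
    ≡⟨ ∑-concatMap _ g (firstParts (suc n) m) ⟩
  ∑ (firstParts (suc n) m) (λ j → ∑ (map (j ∷_) (ptnsAux f (suc n ∸ j) j)) g)
    ≡⟨ ∑-cong (firstParts (suc n) m) (λ j → ∑-map (j ∷_) g (ptnsAux f (suc n ∸ j) j)) ⟩
  ∑ (firstParts (suc n) m) (λ j → ∑ (ptnsAux f (suc n ∸ j) j) (g ∘ (j ∷_)))
    ≡⟨ ∑-single (firstParts-unique (suc n) m) (∈-firstParts⁺ 1≤k k≤n k≤m) other ⟩
  ∑ (ptnsAux f (suc n ∸ k) k) (g ∘ (k ∷_))
    ≡⟨ ∑-ptnsAux-single f (suc n ∸ k) k (g ∘ (k ∷_)) (fuel 1≤k) d rest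
         (λ d′ μ≢σ → h (step 1≤k k≤m d′) (λ { refl → μ≢σ refl })) ⟩
  g (k ∷ σ) ∎
  where
  open ≡-Reasoning
  k≤n : k ≤ suc n
  k≤n = ℕ.m+n≤o⇒m≤o k (ℕ.≤-reflexive e)
  rest : sum σ ≡ suc n ∸ k
  rest = trans (sym (ℕ.m+n∸m≡n k (sum σ))) (cong (_∸ k) e)
  -- A part is at least 1, so the size left drops at least as fast as the fuel.
  fuel : ∀ {k} → 1 ≤ k → suc n ∸ k ≤ f
  fuel {suc k} _ = ℕ.≤-trans (ℕ.m∸n≤m n k) n≤f
  other : ∀ {j} → j ∈ firstParts (suc n) m → j ≢ k →
          ∑ (ptnsAux f (suc n ∸ j) j) (g ∘ (j ∷_)) ≡ + 0
  other {j} j∈ j≢k with ∈-firstParts⁻ (suc n) m j∈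
  ... | 1≤j , _ , j≤m = ∑-0 (ptnsAux f (suc n ∸ j) j) (λ μ∈ →
    h (step 1≤j j≤m (proj₁ (ptnsAux-sound f (suc n ∸ j) j μ∈))) (λ { refl → j≢k refl }))

-- Reversed, so that sorting produces weakly decreasing lists, the form in which partitions are
-- listed.
≥-order : DecTotalOrder _ _ _
≥-order = decTotalOrder ℕ.≤-decTotalOrder

open Sort ≥-order using (sort; sort-↭; sort-↗)

≥-Linked⇒Desc : ∀ {m σ} → All (_≤ m) σ → All (1 ≤_) σ → Linked (λ x y → y ≤ x) σ → Desc m σ
≥-Linked⇒Desc []          []            _        = []
≥-Linked⇒Desc (x≤m ∷ _) (1≤x ∷ [])      [-]      = step 1≤x x≤m []
≥-Linked⇒Desc {m} {x ∷ y ∷ σ} (x≤m ∷ b) (1≤x ∷ pos) (y≤x ∷ l) = step 1≤x x≤m (relax y≤x (≥-Linked⇒Desc b pos l))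
  where
  relax : ∀ {m m′ y σ} → y ≤ m′ → Desc m (y ∷ σ) → Desc m′ (y ∷ σ)
  relax y≤m′ (step 1≤y _ d) = step 1≤y y≤m′ d

Desc⇒≥-Linked : ∀ {m σ} → Desc m σ → Linked (λ x y → y ≤ x) σ
Desc⇒≥-Linked []                            = []
Desc⇒≥-Linked (step _ _ [])                 = [-]
Desc⇒≥-Linked (step _ _ d@(step _ y≤x _))   = y≤x ∷ Desc⇒≥-Linked d

Desc-↭-unique : ∀ {m σ τ} → Desc m σ → Desc m τ → σ ↭ τ → σ ≡ τ
Desc-↭-unique d d′ r =
  Pointwise-≡⇒≡ (↗↭↗⇒≋ (DecTotalOrder.totalOrder ≥-order) (Desc⇒≥-Linked d) (Desc⇒≥-Linked d′) (↭⇒↭ₛ r))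

Desc-positive : ∀ {m σ} → Desc m σ → All (1 ≤_) σ
Desc-positive []             = []
Desc-positive (step 1≤k _ d) = 1≤k ∷ Desc-positive d

-- The single partition that matches is the decreasing rearrangement of `s`, and two decreasing
-- lists with the same entries coincide.
∑-partitions-multisetEq : ∀ {s} n → sum s ≡ n → All (1 ≤_) s →
                          ∑ (partitions n) (λ μ → ⟦ multisetEq s μ ⟧) ≡ + 1
∑-partitions-multisetEq {s} n refl pos =
  trans (∑-ptnsAux-single n n n (λ μ → ⟦ multisetEq s μ ⟧) ℕ.≤-refl desc (sum-↭ (sort-↭ s)) other)
        (cong ⟦_⟧ (↭⇒multisetEq (↭-sym (sort-↭ s))))
  where
  desc : Desc n (sort s)
  desc = ≥-Linked⇒Desc (All-resp-↭ (↭-sym (sort-↭ s)) (All≤sum s)) (All-resp-↭ (↭-sym (sort-↭ s)) pos) (sort-↗ s)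
  other : ∀ {μ} → Desc n μ → μ ≢ sort s → ⟦ multisetEq s μ ⟧ ≡ + 0
  other {μ} d μ≢ with multisetEq s μ in eq
  ... | false = refl
  ... | true  = contradiction (Desc-↭-unique d desc (↭-sym (↭-trans (sort-↭ s) (multisetEq⇒↭ eq)))) μ≢

-- Colourings of complete multipartite graphs

all-↭ : ∀ {A : Set} (p : A → Bool) {xs ys} → xs ↭ ys → all p xs ≡ all p ys
all-↭ p {xs} {ys} r = ≡-from-⇔
  (λ h → all-true⁺ ys (λ y∈ → all-true⁻ h (∈-resp-↭ (↭-sym r) y∈)))
  (λ h → all-true⁺ xs (λ x∈ → all-true⁻ h (∈-resp-↭ r x∈)))

all-tabulate : ∀ {A : Set} (p : A → Bool) {n} (f : Fin n → A) → all p (tabulate f) ≡ all (p ∘ f) (allFin n)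
all-tabulate p {n} f = trans (cong (all p) (sym (map-tabulate id f))) (all-map p f (allFin n))

count-tabulate : ∀ {A : Set} (p : A → Bool) {n} (f : Fin n → A) → count p (tabulate f) ≡ count (p ∘ f) (allFin n)
count-tabulate p {n} f = trans (cong (count p) (sym (map-tabulate id f))) (count-map p f (allFin n))

-- A pair (x , c) is a vertex in stable set x with colour c.
separated : ∀ {L : Set} {k} → (L → L → Bool) → List (L × Fin k) → Bool
separated _≈ᵇ_ zs = all (λ p → all (λ q → (proj₁ p ≈ᵇ proj₁ q) ∨ not (proj₂ p ==F proj₂ q)) zs) zs

contentIs : ∀ {L : Set} {k} → (Fin k → ℕ) → List (L × Fin k) → Bool
contentIs {k = k} α zs = all (λ c → count (λ p → proj₂ p ==F c) zs ≡ᵇ α c) (allFin k)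

separated-↭ : ∀ {L : Set} {k} (_≈ᵇ_ : L → L → Bool) {zs zs′ : List (L × Fin k)} →
              zs ↭ zs′ → separated _≈ᵇ_ zs ≡ separated _≈ᵇ_ zs′
separated-↭ _ {zs} r = trans (all-cong (λ p → all-↭ _ r) zs) (all-↭ _ r)

contentIs-↭ : ∀ {L : Set} {k} (α : Fin k → ℕ) {zs zs′ : List (L × Fin k)} →
              zs ↭ zs′ → contentIs α zs ≡ contentIs α zs′
contentIs-↭ {k = k} α r = all-cong (λ c → cong (_≡ᵇ α c) (count-↭ _ r)) (allFin k)

-- Runs along a list of labels instead of over `Vec (Fin k) N`, so that vertex sets numbered
-- differently, or of sizes equal only up to proof, can be compared without transport.
colourings : ∀ {L : Set} k → List L → (List (L × Fin k) → Bool) → ℤ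
colourings k []       Q = ⟦ Q [] ⟧
colourings k (x ∷ ls) Q = ∑ (allFin k) (λ c → colourings k ls (λ zs → Q ((x , c) ∷ zs)))

colourings-cong : ∀ {L : Set} k (ls : List L) {Q R : List (L × Fin k) → Bool} →
                  (∀ zs → Q zs ≡ R zs) → colourings k ls Q ≡ colourings k ls R
colourings-cong k []       h = cong ⟦_⟧ (h [])
colourings-cong k (x ∷ ls) h = ∑-cong (allFin k) (λ c → colourings-cong k ls (λ zs → h ((x , c) ∷ zs)))

-- Isomorphism invariance of the colouring count: swapping two vertices exchanges two adjacent
-- summations, and the symmetry of `Q` absorbs the change of order in its argument.
colourings-↭ : ∀ {L : Set} k {ls ls′ : List L} {Q : List (L × Fin k) → Bool} →
               (∀ {zs zs′} → zs ↭ zs′ → Q zs ≡ Q zs′) → ls ↭ ls′ → colourings k ls Q ≡ colourings k ls′ Q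
colourings-↭ k h ↭-refl     = refl
colourings-↭ k h (prep x r) = ∑-cong (allFin k) (λ c → colourings-↭ k (λ s → h (prep (x , c) s)) r)
colourings-↭ k {Q = Q} h (swap {ls} {ls′} x y r) =
  trans (∑-swap (λ c d → colourings k ls (λ zs → Q ((x , c) ∷ (y , d) ∷ zs))) (allFin k) (allFin k))
        (∑-cong (allFin k) (λ d → ∑-cong (allFin k) (λ c →
          trans (colourings-↭ k (λ s → h (prep (x , c) (prep (y , d) s))) r)
                (colourings-cong k ls′ (λ zs → h (swap (x , c) (y , d) ↭-refl))))))
colourings-↭ k h (↭-trans′ r s) = trans (colourings-↭ k h r) (colourings-↭ k h s)

colourings-map : ∀ {L M : Set} k (g : L → M) ls (Q : List (M × Fin k) → Bool) →
                 colourings k (map g ls) Q ≡ colourings k ls (λ zs → Q (map (map₁ g) zs))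
colourings-map k g []       Q = refl
colourings-map k g (x ∷ ls) Q = ∑-cong (allFin k) (λ c → colourings-map k g ls (λ zs → Q ((g x , c) ∷ zs)))

∑-colourings : ∀ {L : Set} k n (lab : Fin n → L) (Q : List (L × Fin k) → Bool) →
               ∑ (allVec n k) (λ κ → ⟦ Q (tabulate (λ v → lab v , lookup κ v)) ⟧) ≡ colourings k (tabulate lab) Q
∑-colourings k zero    lab Q = ℤ.+-identityʳ _
∑-colourings k (suc n) lab Q =
  trans (∑-allVec n k _)
        (∑-cong (allFin k) (λ c → ∑-colourings k n (lab ∘ suc) (λ zs → Q ((lab zero , c) ∷ zs))))

all-false⁻ : ∀ {A : Set} {p : A → Bool} xs → all p xs ≡ false → ∃ λ x → p x ≡ false
all-false⁻ {p = p} (x ∷ xs) e with p x in eq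
... | false = x , eq
... | true  = all-false⁻ xs e

-- The disjunction in proper is local to Defs and cannot be named here, so its
-- values are only ever inspected as hypotheses.
proper≡ : ∀ {N k} (H : Graph N) (κ : Vec (Fin k) N) →
          proper H κ ≡ all (λ u → all (λ v → not (H u v) ∨ not (lookup κ u ==F lookup κ v)) (allFin N)) (allFin N)
proper≡ {N} H κ with proper H κ in eq
... | true  = sym (all-true⁺ (allFin N) (λ {u} _ → all-true⁺ (allFin N) (λ {v} _ → holds u v)))
  where
  holds : ∀ u v → not (H u v) ∨ not (lookup κ u ==F lookup κ v) ≡ true
  holds u v with H u v | all-true⁻ (all-true⁻ eq (∈-allFin u)) (∈-allFin v)
  ... | false | _ = refl
  ... | true  | e = e
... | false with all-false⁻ (allFin N) eq
...   | u , e with all-false⁻ (allFin N) e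
...     | v , e′ with H u v in Huv | e′
...       | true | e″ = sym (fails (λ h → contradiction
    (trans (sym e″) (subst (λ b → not b ∨ not (lookup κ u ==F lookup κ v) ≡ true) Huv
      (all-true⁻ (all-true⁻ h (∈-allFin u)) (∈-allFin v)))) (λ ())))
  where
  fails : ∀ {a} → a ≢ true → a ≡ false
  fails {true}  h = contradiction refl h
  fails {false} h = refl

proper-Gμ : ∀ {k} μ (κ : Vec (Fin k) (sum μ)) →
            proper (Gμ μ) κ ≡ separated _≡ᵇ_ (tabulate (λ v → blockOf μ (toℕ v) , lookup κ v))
proper-Gμ μ κ = trans (proper≡ (Gμ μ) κ) (sym (trans (all-tabulate _ z)
  (all-cong (λ u → trans (all-tabulate _ z)
    (all-cong (λ v → cong (_∨ not (lookup κ u ==F lookup κ v)) (sym (not-involutive _))) (allFin (sum μ))))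
    (allFin (sum μ)))))
  where
  z = λ v → blockOf μ (toℕ v) , lookup κ v

coefX-colourings : ∀ μ k α → + coefX (Gμ μ) k α ≡
  colourings k (tabulate {n = sum μ} (blockOf μ ∘ toℕ)) (λ zs → separated _≡ᵇ_ zs ∧ contentIs α zs)
coefX-colourings μ k α = begin
  + coefX (Gμ μ) k α
    ≡⟨ count-∑ℤ _ (allVec (sum μ) k) ⟩
  ∑ (allVec (sum μ) k) (λ κ → ⟦ proper (Gμ μ) κ ∧ hasContent α κ ⟧)
    ≡⟨ ∑-cong (allVec (sum μ) k) (λ κ → cong₂ (λ a b → ⟦ a ∧ b ⟧) (proper-Gμ μ κ)
         (all-cong (λ c → cong (_≡ᵇ α c) (sym (count-tabulate _ (λ v → blockOf μ (toℕ v) , lookup κ v)))) (allFin k))) ⟩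
  ∑ (allVec (sum μ) k) (λ κ → ⟦ Q (tabulate (λ v → blockOf μ (toℕ v) , lookup κ v)) ⟧)
    ≡⟨ ∑-colourings k (sum μ) (blockOf μ ∘ toℕ) Q ⟩
  colourings k (tabulate {n = sum μ} (blockOf μ ∘ toℕ)) Q ∎
  where
  open ≡-Reasoning
  Q = λ zs → separated _≡ᵇ_ zs ∧ contentIs α zs

-- Matching the stable sets of G_μ with the blocks of a set partition

applyUpTo-+ : ∀ {A : Set} (f : ℕ → A) m n → applyUpTo f (m ℕ.+ n) ≡ applyUpTo f m ++ applyUpTo (f ∘ (m ℕ.+_)) n
applyUpTo-+ f zero    n = refl
applyUpTo-+ f (suc m) n = cong (f 0 ∷_) (applyUpTo-+ (f ∘ suc) m n)

applyUpTo-const : ∀ {A : Set} {f : ℕ → A} {x} n → (∀ i → i < n → f i ≡ x) → applyUpTo f n ≡ replicate n x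
applyUpTo-const zero    h = refl
applyUpTo-const (suc n) h = cong₂ _∷_ (h 0 (s≤s z≤n)) (applyUpTo-const n (λ i i<n → h (suc i) (s≤s i<n)))

applyUpTo-cong : ∀ {A : Set} {f g : ℕ → A} n → (∀ i → f i ≡ g i) → applyUpTo f n ≡ applyUpTo g n
applyUpTo-cong zero    h = refl
applyUpTo-cong (suc n) h = cong₂ _∷_ (h 0) (applyUpTo-cong n (h ∘ suc))

blockLabels : List ℕ → List ℕ
blockLabels μ = applyUpTo (blockOf μ) (sum μ)

-- The first stable set gives a run of zeros and shifts all later labels by one, which allows
-- induction on the parts.
blockLabels-∷ : ∀ p μ → blockLabels (p ∷ μ) ≡ replicate p 0 ++ map suc (blockLabels μ)
blockLabels-∷ p μ = trans (applyUpTo-+ (blockOf (p ∷ μ)) p (sum μ)) (cong₂ _++_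
  (applyUpTo-const p inside)
  (trans (applyUpTo-cong (sum μ) beyond) (sym (map-applyUpTo (blockOf μ) suc (sum μ)))))
  where
  <⇒≤ᵇ : ∀ {i p} → i < p → (suc i ≤ᵇ p) ≡ true
  <⇒≤ᵇ {i} {p} i<p with suc i ≤ᵇ p | ℕ.≤⇒≤ᵇ i<p
  ... | true | _ = refl
  inside : ∀ i → i < p → blockOf (p ∷ μ) i ≡ 0
  inside i i<p = cong (λ b → if b then 0 else suc (blockOf μ (i ∸ p))) (<⇒≤ᵇ i<p)
  p+i≮p : ∀ i → (suc (p ℕ.+ i) ≤ᵇ p) ≡ false
  p+i≮p i with suc (p ℕ.+ i) ≤ᵇ p in eq
  ... | false = refl
  ... | true  = contradiction (ℕ.m+n≤o⇒m≤o (suc p) (ℕ.≤ᵇ⇒≤ (suc (p ℕ.+ i)) p (subst T (sym eq) _))) ℕ.1+n≰n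
  beyond : ∀ i → blockOf (p ∷ μ) (p ℕ.+ i) ≡ suc (blockOf μ i)
  beyond i = trans (cong (λ b → if b then 0 else suc (blockOf μ (p ℕ.+ i ∸ p))) (p+i≮p i))
                   (cong (suc ∘ blockOf μ) (ℕ.m+n∸m≡n p i))

occ-replicate : ∀ v n x → occ v (replicate n x) ≡ n ℕ.* bit (x ≡ᵇ v)
occ-replicate v zero    x = refl
occ-replicate v (suc n) x = trans (count-∷ _ x (replicate n x)) (cong (bit (x ≡ᵇ v) ℕ.+_) (occ-replicate v n x))

occ-0-map-suc : ∀ xs → occ 0 (map suc xs) ≡ 0
occ-0-map-suc xs = occ-∉ (map suc xs) (λ 0∈ → contradiction (proj₂ (proj₂ (∈-map⁻ suc 0∈))) (λ ()))

occ-suc-blockLabels : ∀ v p μ → occ (suc v) (blockLabels (p ∷ μ)) ≡ occ v (blockLabels μ)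
occ-suc-blockLabels v p μ = begin
  occ (suc v) (blockLabels (p ∷ μ))                                    ≡⟨ cong (occ (suc v)) (blockLabels-∷ p μ) ⟩
  occ (suc v) (replicate p 0 ++ map suc (blockLabels μ))               ≡⟨ count-++ _ (replicate p 0) _ ⟩
  occ (suc v) (replicate p 0) ℕ.+ occ (suc v) (map suc (blockLabels μ))
    ≡⟨ cong₂ ℕ._+_ (trans (occ-replicate (suc v) p 0) (ℕ.*-zeroʳ p)) (count-map _ suc (blockLabels μ)) ⟩
  occ v (blockLabels μ)                                                ∎
  where open ≡-Reasoning

occ-blockLabels : ∀ μ i → occ (toℕ i) (blockLabels μ) ≡ List.lookup μ i
occ-blockLabels (p ∷ μ) zero = begin
  occ 0 (blockLabels (p ∷ μ))                                ≡⟨ cong (occ 0) (blockLabels-∷ p μ) ⟩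
  occ 0 (replicate p 0 ++ map suc (blockLabels μ))           ≡⟨ count-++ _ (replicate p 0) _ ⟩
  occ 0 (replicate p 0) ℕ.+ occ 0 (map suc (blockLabels μ))
    ≡⟨ cong₂ ℕ._+_ (trans (occ-replicate 0 p 0) (ℕ.*-identityʳ p)) (occ-0-map-suc (blockLabels μ)) ⟩
  p ℕ.+ 0                                                    ≡⟨ ℕ.+-identityʳ p ⟩
  p                                                          ∎
  where open ≡-Reasoning
occ-blockLabels (p ∷ μ) (suc i) = trans (occ-suc-blockLabels (toℕ i) p μ) (occ-blockLabels μ i)

occ-blockLabels-beyond : ∀ μ v → length μ ≤ v → occ v (blockLabels μ) ≡ 0
occ-blockLabels-beyond []      v       _         = refl
occ-blockLabels-beyond (p ∷ μ) (suc v) (s≤s l≤v) =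
  trans (occ-suc-blockLabels v p μ) (occ-blockLabels-beyond μ v l≤v)

-- The permutation between the block sizes and `μ` acts on positions. This bijection sends each
-- block to a stable set of the same size, so the two lists of vertex labels agree as multisets. The
-- casts bridge `Fin (length μ)` and the index type of the tabulated list of sizes.
module Relabelling {n : ℕ} (μ : List ℕ) (b : Vec (Fin (length μ)) n) (sizes : tabulate (cnt b) ↭ μ) where
  private
    π = Homogeneous.onIndices (↭⇒↭ₛ sizes)
    len = length-tabulate (cnt b)

  relabel : Fin (length μ) → Fin (length μ)
  relabel j = Inverse.to π (cast (sym len) j)

  unlabel : Fin (length μ) → Fin (length μ)
  unlabel i = cast len (Inverse.from π i)

  relabel-unlabel : ∀ i → relabel (unlabel i) ≡ i
  relabel-unlabel i = Inverse.inverseˡ π (trans (cast-trans len (sym len) _) (cast-is-id _ _))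

  unlabel-relabel : ∀ j → unlabel (relabel j) ≡ j
  unlabel-relabel j =
    trans (cong (cast len) (Inverse.inverseʳ π refl)) (trans (cast-trans (sym len) len j) (cast-is-id _ j))

  relabel-==F : ∀ i j → (relabel i ==F relabel j) ≡ (i ==F j)
  relabel-==F i j = ≡-from-⇔
    (λ h → ≡ᵇ-complete (cong toℕ (trans (sym (unlabel-relabel i)) (trans (cong unlabel (==F-sound h)) (unlabel-relabel j)))))
    (λ h → ≡ᵇ-complete (cong (toℕ ∘ relabel) (==F-sound {a = i} {b = j} h)))

  cnt-relabel : ∀ j → cnt b j ≡ List.lookup μ (relabel j)
  cnt-relabel j = trans (sym (lookup-tabulate (cnt b) j)) (onIndices-lookup (setoid ℕ) (↭⇒↭ₛ sizes) _)

  newLabels : List ℕ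
  newLabels = map (toℕ ∘ relabel) (tabulate (lookup b))

  occ-newLabels : ∀ j → occ (toℕ (relabel j)) newLabels ≡ cnt b j
  occ-newLabels j = begin
    occ (toℕ (relabel j)) newLabels                                     ≡⟨ count-map _ _ (tabulate (lookup b)) ⟩
    count (λ i → relabel i ==F relabel j) (tabulate (lookup b))         ≡⟨ count-cong (λ i → relabel-==F i j) (tabulate (lookup b)) ⟩
    count (_==F j) (tabulate (lookup b))                                ≡⟨ count-tabulate (_==F j) (lookup b) ⟩
    cnt b j                                                             ∎
    where open ≡-Reasoning

  newLabels↭ : newLabels ↭ blockLabels μ
  newLabels↭ = occ⇒↭ _ _ same
    where
    at : ∀ i → occ (toℕ i) newLabels ≡ occ (toℕ i) (blockLabels μ)
    at i = begin
      occ (toℕ i) newLabels                        ≡⟨ cong (λ j → occ (toℕ j) newLabels) (relabel-unlabel i) ⟨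
      occ (toℕ (relabel (unlabel i))) newLabels    ≡⟨ occ-newLabels (unlabel i) ⟩
      cnt b (unlabel i)                            ≡⟨ cnt-relabel (unlabel i) ⟩
      List.lookup μ (relabel (unlabel i))          ≡⟨ cong (List.lookup μ) (relabel-unlabel i) ⟩
      List.lookup μ i                              ≡⟨ occ-blockLabels μ i ⟨
      occ (toℕ i) (blockLabels μ)                  ∎
      where open ≡-Reasoning
    same : ∀ v → occ v newLabels ≡ occ v (blockLabels μ)
    same v with v ℕ.<? length μ
    ... | yes v<l = subst (λ w → occ w newLabels ≡ occ w (blockLabels μ)) (toℕ-fromℕ< v<l) (at (fromℕ< v<l))
    ... | no v≮l  = trans
      (occ-∉ newLabels (λ v∈ → let (j , _ , v≡) = ∈-map⁻ (toℕ ∘ relabel) v∈ in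
        v≮l (subst (_< length μ) (sym v≡) (toℕ<n (relabel j)))))
      (sym (occ-blockLabels-beyond μ v (ℕ.≮⇒≥ v≮l)))

compatible : ∀ {n k l} → Vec (Fin k) n → Vec (Fin l) n → Bool
compatible κ b = separated _==F_ (tabulate (λ v → lookup b v , lookup κ v))

-- G_μ is isomorphic to the complete multipartite graph whose stable sets are the blocks of b.
coefX-via-blocks : ∀ {n} μ (b : Vec (Fin (length μ)) n) → blockSizes b ↭ μ → ∀ k α →
                   + coefX (Gμ μ) k α ≡ ∑ (allVec n k) (λ κ → ⟦ compatible κ b ∧ hasContent α κ ⟧)
coefX-via-blocks {n} μ b sizes k α = begin
  + coefX (Gμ μ) k α
    ≡⟨ coefX-colourings μ k α ⟩
  colourings k (tabulate {n = sum μ} (blockOf μ ∘ toℕ)) (Q _≡ᵇ_)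
    ≡⟨ cong (λ ls → colourings k ls (Q _≡ᵇ_)) (tabulate-toℕ (sum μ) (blockOf μ)) ⟩
  colourings k (blockLabels μ) (Q _≡ᵇ_)
    ≡⟨ colourings-↭ k (λ r → cong₂ _∧_ (separated-↭ _≡ᵇ_ r) (contentIs-↭ α r)) newLabels↭ ⟨
  colourings k newLabels (Q _≡ᵇ_)
    ≡⟨ colourings-map k (toℕ ∘ relabel) (tabulate (lookup b)) (Q _≡ᵇ_) ⟩
  colourings k (tabulate (lookup b)) (λ zs → Q _≡ᵇ_ (map (map₁ (toℕ ∘ relabel)) zs))
    ≡⟨ colourings-cong k (tabulate (lookup b)) (λ zs → cong₂ _∧_ (forget zs)
         (all-cong (λ c → cong (_≡ᵇ α c) (count-map _ (map₁ (toℕ ∘ relabel)) zs)) (allFin k))) ⟩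
  colourings k (tabulate (lookup b)) (Q _==F_)
    ≡⟨ ∑-colourings k n (lookup b) (Q _==F_) ⟨
  ∑ (allVec n k) (λ κ → ⟦ Q _==F_ (tabulate (λ v → lookup b v , lookup κ v)) ⟧)
    ≡⟨ ∑-cong (allVec n k) (λ κ → cong (λ h → ⟦ compatible κ b ∧ h ⟧)
         (all-cong (λ c → cong (_≡ᵇ α c) (count-tabulate _ (λ v → lookup b v , lookup κ v))) (allFin k))) ⟩
  ∑ (allVec n k) (λ κ → ⟦ compatible κ b ∧ hasContent α κ ⟧) ∎
  where
  open ≡-Reasoning
  open Relabelling μ b (subst (_↭ μ) (blockSizes≡ b) sizes)
  Q : ∀ {L : Set} → (L → L → Bool) → List (L × Fin k) → Bool
  Q _≈ᵇ_ zs = separated _≈ᵇ_ zs ∧ contentIs α zs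
  -- Adjacency depends only on whether labels are equal, and `relabel` is injective.
  forget : ∀ zs → separated _≡ᵇ_ (map (map₁ (toℕ ∘ relabel)) zs) ≡ separated _==F_ zs
  forget zs = trans (all-map _ _ zs) (all-cong (λ p → trans (all-map _ _ zs)
    (all-cong (λ q → cong (_∨ not (proj₂ p ==F proj₂ q)) (relabel-==F (proj₁ p) (proj₁ q))) zs)) zs)

-- Ordered set partitions compatible with a fixed colouring

-- Equivalently, the pairs define a partial function from colours to blocks.
Sep : ∀ {k l} → List (Fin l × Fin k) → Set
Sep zs = ∀ {p q} → p ∈ zs → q ∈ zs → proj₂ p ≡ proj₂ q → proj₁ p ≡ proj₁ q

separated⁻ : ∀ {k l} (zs : List (Fin l × Fin k)) → separated _==F_ zs ≡ true → Sep zs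
separated⁻ zs e {p} {q} p∈ q∈ c≡ with proj₁ p ==F proj₁ q in eq | all-true⁻ (all-true⁻ e p∈) q∈
... | true  | _ = ==F-sound eq
... | false | h rewrite c≡ | ≡ᵇ-refl (toℕ (proj₂ q)) with h
...   | ()

separated⁺ : ∀ {k l} (zs : List (Fin l × Fin k)) → Sep zs → separated _==F_ zs ≡ true
separated⁺ zs sep = all-true⁺ zs (λ {p} p∈ → all-true⁺ zs (λ {q} q∈ → holds p q p∈ q∈))
  where
  holds : ∀ p q → p ∈ zs → q ∈ zs → (proj₁ p ==F proj₁ q) ∨ not (proj₂ p ==F proj₂ q) ≡ true
  holds p q p∈ q∈ with proj₂ p ==F proj₂ q in eq
  ... | true  rewrite sep p∈ q∈ (==F-sound eq) = cong (_∨ false) (≡ᵇ-refl (toℕ (proj₁ q)))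
  ... | false with proj₁ p ==F proj₁ q
  ...   | true  = refl
  ...   | false = refl

mem : ∀ {k} → Fin k → List (Fin k) → Bool
mem c []       = false
mem c (d ∷ cs) = (d ==F c) ∨ mem c cs

mem⁻ : ∀ {k} {c : Fin k} cs → mem c cs ≡ true → c ∈ cs
mem⁻ {c = c} (d ∷ cs) e with d ==F c in eq
... | true  = here (sym (==F-sound eq))
... | false = there (mem⁻ cs e)

mem⁺ : ∀ {k} {c : Fin k} {cs} → c ∈ cs → mem c cs ≡ true
mem⁺ {c = c} (here refl) rewrite ≡ᵇ-refl (toℕ c) = refl
mem⁺ {c = c} {d ∷ cs} (there c∈) with d ==F c
... | true  = refl
... | false = mem⁺ c∈

mem-count : ∀ {k} (c : Fin k) cs → mem c cs ≡ not (count (_==F c) cs ≡ᵇ 0)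
mem-count c []       = refl
mem-count c (d ∷ cs) with d ==F c
... | true  = refl
... | false = mem-count c cs

covers : ∀ {k l} → List (Fin l × Fin k) → Bool
covers {l = l} zs = all (λ j → mem j (map proj₁ zs)) (allFin l)

mem-↭ : ∀ {k} (c : Fin k) {cs ds} → cs ↭ ds → mem c cs ≡ mem c ds
mem-↭ c {cs} {ds} r = ≡-from-⇔ (λ h → mem⁺ (∈-resp-↭ r (mem⁻ cs h))) (λ h → mem⁺ (∈-resp-↭ (↭-sym r) (mem⁻ ds h)))

covers-↭ : ∀ {k l} {zs zs′ : List (Fin l × Fin k)} → zs ↭ zs′ → covers zs ≡ covers zs′
covers-↭ {l = l} r = all-cong (λ j → mem-↭ j (map⁺ proj₁ r)) (allFin l)

-- The number of distinct colours of `κ` outside `cs`. With `cs` holding just the colour of the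
-- first vertex, this is the t of the overview.
fresh : ∀ {n k} → Vec (Fin k) n → List (Fin k) → ℕ
fresh []      cs = 0
fresh (c ∷ κ) cs = bit (not (mem c cs)) ℕ.+ fresh κ (c ∷ cs)

fresh≤n : ∀ {n k} (κ : Vec (Fin k) n) cs → fresh κ cs ≤ n
fresh≤n []      cs = z≤n
fresh≤n (c ∷ κ) cs with mem c cs
... | true  = ℕ.m≤n⇒m≤1+n (fresh≤n κ (c ∷ cs))
... | false = s≤s (fresh≤n κ (c ∷ cs))

-- A t l s counts the maps from t points to l blocks that hit all but s given blocks.
A : ℕ → ℕ → ℕ → ℤ
A zero    l s = ⟦ l ≡ᵇ s ⟧
A (suc t) l s = + s ℤ.* A t l s ℤ.+ (+ l ℤ.- + s) ℤ.* A t l (suc s)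

count≤length : ∀ {X : Set} (p : X → Bool) xs → count p xs ≤ length xs
count≤length p []       = z≤n
count≤length p (x ∷ xs) with p x
... | true  = s≤s (count≤length p xs)
... | false = ℕ.m≤n⇒m≤1+n (count≤length p xs)

all≡count : ∀ {X : Set} (p : X → Bool) xs → all p xs ≡ (length xs ≡ᵇ count p xs)
all≡count p []       = refl
all≡count p (x ∷ xs) with p x
... | true  = all≡count p xs
... | false = sym (≡ᵇ-false (λ e → ℕ.<⇒≢ (s≤s (count≤length p xs)) (sym e)))

-- Yields the two terms in the recursion of `A`: blocks already hit and blocks still empty.
∑-if : ∀ {X : Set} (p : X → Bool) a b xs →
       ∑ xs (λ x → if p x then a else b) ≡ + count p xs ℤ.* a ℤ.+ (+ length xs ℤ.- + count p xs) ℤ.* b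
∑-if p a b []       = base a b
  where
  base : ∀ a b → + 0 ≡ + 0 ℤ.* a ℤ.+ (+ 0 ℤ.- + 0) ℤ.* b
  base = solve-∀
∑-if p a b (x ∷ xs) with p x
... | true  = trans (cong (λ z → a ℤ.+ z) (∑-if p a b xs)) (hit a b (+ count p xs) (+ length xs))
  where
  hit : ∀ a b c n → a ℤ.+ (c ℤ.* a ℤ.+ (n ℤ.- c) ℤ.* b) ≡ (+ 1 ℤ.+ c) ℤ.* a ℤ.+ ((+ 1 ℤ.+ n) ℤ.- (+ 1 ℤ.+ c)) ℤ.* b
  hit = solve-∀
... | false = trans (cong (λ z → b ℤ.+ z) (∑-if p a b xs)) (miss a b (+ count p xs) (+ length xs))
  where
  miss : ∀ a b c n → b ℤ.+ (c ℤ.* a ℤ.+ (n ℤ.- c) ℤ.* b) ≡ c ℤ.* a ℤ.+ ((+ 1 ℤ.+ n) ℤ.- c) ℤ.* b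
  miss = solve-∀

count-insert : ∀ {l} (j : Fin l) (p : Fin l → Bool) →
               count (λ i → (j ==F i) ∨ p i) (allFin l) ≡ (if p j then count p (allFin l) else suc (count p (allFin l)))
count-insert {l} j p with p j in pj
... | true  = count-cong absorb (allFin l)
  where
  absorb : ∀ i → (j ==F i) ∨ p i ≡ p i
  absorb i with j ==F i in eq
  ... | true  rewrite sym (==F-sound {a = j} {b = i} eq) = sym pj
  ... | false = refl
... | false = begin
  count (λ i → (j ==F i) ∨ p i) (allFin l)                    ≡⟨ count-∑ℕ _ (allFin l) ⟩
  ℕ∑ (allFin l) (λ i → ⟦ (j ==F i) ∨ p i ⟧ℕ)                  ≡⟨ ∑ℕ.∑-cong (allFin l) disjoint ⟩
  ℕ∑ (allFin l) (λ i → ⟦ j ==F i ⟧ℕ ℕ.+ ⟦ p i ⟧ℕ)             ≡⟨ ∑ℕ.∑-+ _ _ (allFin l) ⟩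
  ℕ∑ (allFin l) (λ i → ⟦ j ==F i ⟧ℕ) ℕ.+ ℕ∑ (allFin l) (λ i → ⟦ p i ⟧ℕ)
    ≡⟨ cong₂ ℕ._+_ (trans (∑ℕ.∑-allFin-single j (λ i i≢j → cong ⟦_⟧ℕ (==F-false (i≢j ∘ sym)))) (cong ⟦_⟧ℕ (≡ᵇ-refl (toℕ j))))
                   (sym (count-∑ℕ p (allFin l))) ⟩
  suc (count p (allFin l)) ∎
  where
  open ≡-Reasoning
  open ∑ℕ using () renaming (∑ to ℕ∑; ⟦_⟧ to ⟦_⟧ℕ)
  disjoint : ∀ i → ⟦ (j ==F i) ∨ p i ⟧ℕ ≡ ⟦ j ==F i ⟧ℕ ℕ.+ ⟦ p i ⟧ℕ
  disjoint i with j ==F i in eq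
  ... | true  rewrite sym (==F-sound {a = j} {b = i} eq) | pj = refl
  ... | false = refl

pairs : ∀ {n k l} → Vec (Fin k) n → Vec (Fin l) n → List (Fin l × Fin k)
pairs κ b = tabulate (λ v → lookup b v , lookup κ v)

used : ∀ {k l} → List (Fin l × Fin k) → ℕ
used {l = l} h = count (λ j → mem j (map proj₁ h)) (allFin l)

-- Here `h` records the vertices already placed, each with its block and colour, and the vertices of
-- `κ` remain to be placed.
extensions : ∀ {n k l} → Vec (Fin k) n → List (Fin l × Fin k) → ℤ
extensions {n} {k} {l} κ h = ∑ (allVec n l) (λ b → ⟦ separated _==F_ (pairs κ b ++ h) ∧ covers (pairs κ b ++ h) ⟧)

extensions-∷ : ∀ {n k l} c (κ : Vec (Fin k) n) (h : List (Fin l × Fin k)) →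
               extensions (c ∷ κ) h ≡ ∑ (allFin l) (λ j → extensions κ ((j , c) ∷ h))
extensions-∷ {n} {l = l} c κ h = trans (∑-allVec n l _) (∑-cong (allFin l) (λ j → ∑-cong (allVec n l) (λ b →
  cong₂ (λ x y → ⟦ x ∧ y ⟧) (separated-↭ _==F_ (move j b)) (covers-↭ (move j b)))))
  where
  move : ∀ j b → (j , c) ∷ pairs κ b ++ h ↭ pairs κ b ++ (j , c) ∷ h
  move j b = ↭-sym (shift (j , c) (pairs κ b) h)

-- A vertex whose colour has been seen is forced into the block of that colour and changes nothing.
-- A vertex of a new colour may enter any block: one of the `used h` blocks already hit, or an empty
-- one, which raises that number by one. This is the recursion of `A`, so only the number of new
-- colours matters.
extensions-A : ∀ {n k l} (κ : Vec (Fin k) n) (h : List (Fin l × Fin k)) → Sep h →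
               extensions κ h ≡ A (fresh κ (map proj₂ h)) l (used h)
extensions-A {l = l} [] h sep = trans (ℤ.+-identityʳ _) (cong ⟦_⟧ (begin
  separated _==F_ h ∧ covers h              ≡⟨ cong (_∧ covers h) (separated⁺ h sep) ⟩
  covers h                                  ≡⟨ all≡count _ (allFin l) ⟩
  (length (allFin l) ≡ᵇ used h)             ≡⟨ cong (_≡ᵇ used h) (length-tabulate {n = l} id) ⟩
  (l ≡ᵇ used h)                             ∎))
  where open ≡-Reasoning
extensions-A {n = suc n} {l = l} (c ∷ κ) h sep with mem c (map proj₂ h) in seen
... | true  = trans (extensions-∷ c κ h) (trans (∑-allFin-single j₀ other) (trans (extensions-A κ _ sep′)
                (cong (A (fresh κ (c ∷ map proj₂ h)) l) same)))
  where
  found : ∃ λ p → p ∈ h × c ≡ proj₂ p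
  found = ∈-map⁻ proj₂ (mem⁻ (map proj₂ h) seen)
  j₀ = proj₁ (proj₁ found)
  p∈ : (j₀ , c) ∈ h
  p∈ = subst (λ d → (j₀ , d) ∈ h) (sym (proj₂ (proj₂ found))) (proj₁ (proj₂ found))
  other : ∀ j → j ≢ j₀ → extensions κ ((j , c) ∷ h) ≡ + 0
  other j j≢ = ∑-0 (allVec n l) (λ {b} _ → zero! b)
    where
    zero! : ∀ b → ⟦ separated _==F_ (pairs κ b ++ (j , c) ∷ h) ∧ covers (pairs κ b ++ (j , c) ∷ h) ⟧ ≡ + 0
    zero! b with separated _==F_ (pairs κ b ++ (j , c) ∷ h) in eq
    ... | false = refl
    ... | true  = contradiction
      (separated⁻ (pairs κ b ++ (j , c) ∷ h) eq (∈-++⁺ʳ (pairs κ b) (here refl)) (∈-++⁺ʳ (pairs κ b) (there p∈)) refl) j≢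
  sep′ : Sep ((j₀ , c) ∷ h)
  sep′ (here refl) (here refl) _ = refl
  sep′ (here refl) (there q∈)  e = sep p∈ q∈ e
  sep′ (there q∈)  (here refl) e = sep q∈ p∈ e
  sep′ (there q∈)  (there q∈′) e = sep q∈ q∈′ e
  same : used ((j₀ , c) ∷ h) ≡ used h
  same = trans (count-insert j₀ (λ j → mem j (map proj₁ h)))
    (cong (λ b → if b then used h else suc (used h)) (mem⁺ (∈-map⁺ proj₁ p∈)))
... | false = begin
  extensions (c ∷ κ) h
    ≡⟨ extensions-∷ c κ h ⟩
  ∑ (allFin l) (λ j → extensions κ ((j , c) ∷ h))
    ≡⟨ ∑-cong (allFin l) (λ j → trans (extensions-A κ ((j , c) ∷ h) (sep′ j))
         (trans (cong (A t l) (count-insert j (λ i → mem i (map proj₁ h)))) (push (mem j (map proj₁ h))))) ⟩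
  ∑ (allFin l) (λ j → if mem j (map proj₁ h) then A t l (used h) else A t l (suc (used h)))
    ≡⟨ ∑-if _ (A t l (used h)) (A t l (suc (used h))) (allFin l) ⟩
  + used h ℤ.* A t l (used h) ℤ.+ (+ length (allFin l) ℤ.- + used h) ℤ.* A t l (suc (used h))
    ≡⟨ cong (λ m → + used h ℤ.* A t l (used h) ℤ.+ (+ m ℤ.- + used h) ℤ.* A t l (suc (used h))) (length-tabulate {n = l} id) ⟩
  A (suc t) l (used h) ∎
  where
  open ≡-Reasoning
  t = fresh κ (c ∷ map proj₂ h)
  new : ∀ {q} → q ∈ h → c ≢ proj₂ q
  new {q} q∈ c≡ = contradiction
    (trans (sym (mem⁺ (subst (_∈ map proj₂ h) (sym c≡) (∈-map⁺ proj₂ q∈)))) seen) (λ ())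
  sep′ : ∀ j → Sep ((j , c) ∷ h)
  sep′ j (here refl) (here refl) _ = refl
  sep′ j (here refl) (there q∈)  e = contradiction e (new q∈)
  sep′ j (there q∈)  (here refl) e = contradiction (sym e) (new q∈)
  sep′ j (there q∈)  (there q∈′) e = sep q∈ q∈′ e
  push : ∀ b → A t l (if b then used h else suc (used h)) ≡ (if b then A t l (used h) else A t l (suc (used h)))
  push true  = refl
  push false = refl

-- The alternating sum over the number of blocks

falling : ℕ → ℕ → ℤ
falling zero    i = + 1
falling (suc r) i = falling r i ℤ.* (+ i ℤ.- + r)

-- Peels off the leading factor, whereas the definition peels off the last one.
falling-suc : ∀ r i → falling (suc r) (suc i) ≡ + suc i ℤ.* falling r i
falling-suc zero    i = base (+ i)
  where
  base : ∀ i → + 1 ℤ.* ((+ 1 ℤ.+ i) ℤ.- + 0) ≡ (+ 1 ℤ.+ i) ℤ.* + 1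
  base = solve-∀
falling-suc (suc r) i =
  trans (cong (λ z → z ℤ.* (+ suc i ℤ.- + suc r)) (falling-suc r i)) (reassoc (+ i) (+ r) (falling r i))
  where
  reassoc : ∀ i r f → (+ 1 ℤ.+ i) ℤ.* f ℤ.* ((+ 1 ℤ.+ i) ℤ.- (+ 1 ℤ.+ r)) ≡ (+ 1 ℤ.+ i) ℤ.* (f ℤ.* (i ℤ.- r))
  reassoc = solve-∀

sign : ℕ → ℤ
sign zero    = + 1
sign (suc i) = ℤ.- sign i

-- The weight (l-1)(l-2)⋯(l-r), with l = i+1 and s = r+1, turns the recursion
-- of A into  altSum (t+1) r = (r+1) altSum t r + altSum t (r+1).
altSum : ℕ → ℕ → ℕ → ℤ
altSum N t r = ∑ (upTo N) (λ i → sign i ℤ.* (falling r i ℤ.* A t (suc i) (suc r)))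

-- With no colours left, all `suc i` blocks must be among the `suc r` already hit, so only `i = r`
-- survives; the value is (-1)^r r!.
altSum-zero : ∀ N r → r < N → altSum N 0 r ≡ sign r ℤ.* falling r r
altSum-zero N r r<N = trans (∑-single (upTo⁺ N) (∈-upTo⁺ r<N) (λ {i} _ i≢r →
    trans (cong (λ b → sign i ℤ.* (falling r i ℤ.* ⟦ b ⟧)) (≡ᵇ-false i≢r)) (kill (sign i) (falling r i))))
  (trans (cong (λ b → sign r ℤ.* (falling r r ℤ.* ⟦ b ⟧)) (≡ᵇ-refl r)) (cong (λ z → sign r ℤ.* z) (ℤ.*-identityʳ _)))
  where
  kill : ∀ a b → a ℤ.* (b ℤ.* + 0) ≡ + 0
  kill = solve-∀

altSum-suc : ∀ N t r → altSum N (suc t) r ≡ + suc r ℤ.* altSum N t r ℤ.+ altSum N t (suc r)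
altSum-suc N t r = begin
  altSum N (suc t) r
    ≡⟨ ∑-cong (upTo N) (λ i → split (sign i) (falling r i) (+ i) (+ r) (A t (suc i) (suc r)) (A t (suc i) (suc (suc r)))) ⟩
  ∑ (upTo N) (λ i → + suc r ℤ.* (sign i ℤ.* (falling r i ℤ.* A t (suc i) (suc r)))
                    ℤ.+ sign i ℤ.* (falling (suc r) i ℤ.* A t (suc i) (suc (suc r))))
    ≡⟨ ∑-+ _ _ (upTo N) ⟩
  ∑ (upTo N) (λ i → + suc r ℤ.* (sign i ℤ.* (falling r i ℤ.* A t (suc i) (suc r)))) ℤ.+ altSum N t (suc r)
    ≡⟨ cong (λ z → z ℤ.+ altSum N t (suc r)) (∑-*ˡ (+ suc r) _ (upTo N)) ⟩
  + suc r ℤ.* altSum N t r ℤ.+ altSum N t (suc r) ∎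
  where
  open ≡-Reasoning
  split : ∀ s f i r a b →
    s ℤ.* (f ℤ.* ((+ 1 ℤ.+ r) ℤ.* a ℤ.+ ((+ 1 ℤ.+ i) ℤ.- (+ 1 ℤ.+ r)) ℤ.* b))
    ≡ (+ 1 ℤ.+ r) ℤ.* (s ℤ.* (f ℤ.* a)) ℤ.+ s ℤ.* (f ℤ.* (i ℤ.- r) ℤ.* b)
  split = solve-∀

-- For one colour the recursion gives (r+1)·(-1)^r r! + (-1)^(r+1) (r+1)! = 0, and for more colours
-- both of its terms vanish by induction. Each use of the recursion may raise `r` by one, so the
-- bound ensures that the truncated sum still contains the last index reached.
altSum-vanishes : ∀ N t r → suc t ℕ.+ r < N → altSum N (suc t) r ≡ + 0
altSum-vanishes N zero r h = begin
  altSum N 1 r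
    ≡⟨ altSum-suc N 0 r ⟩
  + suc r ℤ.* altSum N 0 r ℤ.+ altSum N 0 (suc r)
    ≡⟨ cong₂ (λ x y → + suc r ℤ.* x ℤ.+ y) (altSum-zero N r (ℕ.<-trans (ℕ.n<1+n r) h))
         (trans (altSum-zero N (suc r) h) (cong (λ z → ℤ.- sign r ℤ.* z) (falling-suc r r))) ⟩
  + suc r ℤ.* (sign r ℤ.* falling r r) ℤ.+ ℤ.- sign r ℤ.* (+ suc r ℤ.* falling r r)
    ≡⟨ cancel (+ suc r) (sign r) (falling r r) ⟩
  + 0 ∎
  where
  open ≡-Reasoning
  cancel : ∀ a s f → a ℤ.* (s ℤ.* f) ℤ.+ ℤ.- s ℤ.* (a ℤ.* f) ≡ + 0
  cancel = solve-∀
altSum-vanishes N (suc t) r h = begin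
  altSum N (suc (suc t)) r
    ≡⟨ altSum-suc N (suc t) r ⟩
  + suc r ℤ.* altSum N (suc t) r ℤ.+ altSum N (suc t) (suc r)
    ≡⟨ cong₂ (λ x y → + suc r ℤ.* x ℤ.+ y) (altSum-vanishes N t r (ℕ.<-trans (ℕ.n<1+n _) h))
         (altSum-vanishes N t (suc r) (subst (_< N) (cong suc (sym (ℕ.+-suc t r))) h)) ⟩
  + suc r ℤ.* + 0 ℤ.+ + 0
    ≡⟨ trans (ℤ.+-identityʳ _) (ℤ.*-zeroʳ (+ suc r)) ⟩
  + 0 ∎
  where open ≡-Reasoning

∑-sign-A : ∀ N t → t < N → ∑ (upTo N) (λ i → sign i ℤ.* A t (suc i) 1) ≡ ⟦ t ≡ᵇ 0 ⟧
∑-sign-A N t t<N = trans (∑-cong (upTo N) (λ i → cong (λ z → sign i ℤ.* z) (sym (ℤ.*-identityˡ _)))) (value t t<N)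
  where
  value : ∀ t → t < N → altSum N t 0 ≡ ⟦ t ≡ᵇ 0 ⟧
  value zero    h = altSum-zero N 0 h
  value (suc t) h = altSum-vanishes N t 0 (subst (_< N) (cong suc (sym (ℕ.+-identityʳ t))) h)

-- The expansion of m_n

nonempty : ∀ {n l} → Vec (Fin l) n → Bool
nonempty b = all (λ s → not (s ≡ᵇ 0)) (blockSizes b)

nonempty≡covers : ∀ {n k l} (κ : Vec (Fin k) n) (b : Vec (Fin l) n) → nonempty b ≡ covers (pairs κ b)
nonempty≡covers {l = l} κ b = trans (all-map _ (cnt b) (allFin l)) (all-cong (λ j → sym (begin
  mem j (map proj₁ (pairs κ b))                          ≡⟨ cong (mem j) (map-tabulate (λ v → lookup b v , lookup κ v) proj₁) ⟩
  mem j (tabulate (lookup b))                            ≡⟨ mem-count j (tabulate (lookup b)) ⟩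
  not (count (_==F j) (tabulate (lookup b)) ≡ᵇ 0)        ≡⟨ cong (λ m → not (m ≡ᵇ 0)) (count-tabulate (_==F j) (lookup b)) ⟩
  not (cnt b j ≡ᵇ 0)                                     ∎)) (allFin l))
  where open ≡-Reasoning

rooted : ∀ {n l} → Vec (Fin l) n → Bool
rooted b = nonempty b ∧ firstInBlock0 b

-- The root condition puts the first vertex in block 0, so the placement starts from the single pair
-- `(zero , c)` with one block already hit; hence the last argument 1 of `A`.
∑-rooted-compatible : ∀ {n k} c (κ : Vec (Fin k) n) i →
  ∑ (allVec (suc n) (suc i)) (λ b → ⟦ rooted b ⟧ ℤ.* ⟦ compatible (c ∷ κ) b ⟧) ≡ A (fresh κ (c ∷ [])) (suc i) 1
∑-rooted-compatible {n} {k} c κ i = begin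
  ∑ (allVec (suc n) (suc i)) (λ b → ⟦ rooted b ⟧ ℤ.* ⟦ compatible (c ∷ κ) b ⟧)
    ≡⟨ ∑-allVec n (suc i) _ ⟩
  ∑ (allFin (suc i)) (λ j → ∑ (allVec n (suc i)) (λ b → ⟦ rooted (j ∷ b) ⟧ ℤ.* ⟦ compatible (c ∷ κ) (j ∷ b) ⟧))
    ≡⟨ ∑-allFin-single zero other ⟩
  ∑ (allVec n (suc i)) (λ b → ⟦ rooted (zero ∷ b) ⟧ ℤ.* ⟦ compatible (c ∷ κ) (zero ∷ b) ⟧)
    ≡⟨ ∑-cong (allVec n (suc i)) at-root ⟩
  extensions κ h
    ≡⟨ extensions-A κ h (λ { (here refl) (here refl) _ → refl }) ⟩
  A (fresh κ (c ∷ [])) (suc i) (used h)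
    ≡⟨ cong (A (fresh κ (c ∷ [])) (suc i)) (trans (count-insert (zero {i}) (λ _ → false)) (cong suc (count-none (allFin (suc i))))) ⟩
  A (fresh κ (c ∷ [])) (suc i) 1 ∎
  where
  open ≡-Reasoning
  h : List (Fin (suc i) × Fin k)
  h = (zero , c) ∷ []
  count-none : ∀ {X : Set} (xs : List X) → count (λ _ → false) xs ≡ 0
  count-none []       = refl
  count-none (x ∷ xs) = count-none xs
  other : ∀ j → j ≢ zero → ∑ (allVec n (suc i)) (λ b → ⟦ rooted (j ∷ b) ⟧ ℤ.* ⟦ compatible (c ∷ κ) (j ∷ b) ⟧) ≡ + 0
  other zero    0≢0 = contradiction refl 0≢0
  other (suc j) _   = ∑-0 (allVec n (suc i)) (λ {b} _ →
    trans (cong (λ r → ⟦ r ⟧ ℤ.* ⟦ compatible (c ∷ κ) (suc j ∷ b) ⟧) (∧-zeroʳ (nonempty (suc j ∷ b)))) (ℤ.*-zeroˡ ⟦ compatible (c ∷ κ) (suc j ∷ b) ⟧))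
  at-root : ∀ b → ⟦ rooted (zero ∷ b) ⟧ ℤ.* ⟦ compatible (c ∷ κ) (zero ∷ b) ⟧
                  ≡ ⟦ separated _==F_ (pairs κ b ++ h) ∧ covers (pairs κ b ++ h) ⟧
  at-root b = trans (sym (⟦∧⟧ (rooted (zero ∷ b)) (compatible (c ∷ κ) (zero ∷ b)))) (cong ⟦_⟧ (begin
    rooted (zero ∷ b) ∧ compatible (c ∷ κ) (zero ∷ b)
      ≡⟨ cong (_∧ compatible (c ∷ κ) (zero ∷ b)) (trans (∧-comm (nonempty (zero ∷ b)) true) (nonempty≡covers (c ∷ κ) (zero ∷ b))) ⟩
    covers ((zero , c) ∷ pairs κ b) ∧ separated _==F_ ((zero , c) ∷ pairs κ b)
      ≡⟨ ∧-comm (covers ((zero , c) ∷ pairs κ b)) (separated _==F_ ((zero , c) ∷ pairs κ b)) ⟩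
    separated _==F_ ((zero , c) ∷ pairs κ b) ∧ covers ((zero , c) ∷ pairs κ b)
      ≡⟨ cong₂ _∧_ (separated-↭ _==F_ (∷↭∷ʳ (zero , c) (pairs κ b))) (covers-↭ (∷↭∷ʳ (zero , c) (pairs κ b))) ⟩
    separated _==F_ (pairs κ b ++ h) ∧ covers (pairs κ b ++ h) ∎))

-- No fresh colour means that every further letter is `c`. Since `fresh` records every letter it
-- passes, repeated or not, the induction needs a list `cs` all of whose entries are `c`.
∑-constant : ∀ n {k} (c : Fin k) cs → (∀ d → mem d (c ∷ cs) ≡ (c ==F d)) → (g : Vec (Fin k) n → ℤ) →
             ∑ (allVec n k) (λ κ → g κ ℤ.* ⟦ fresh κ (c ∷ cs) ≡ᵇ 0 ⟧) ≡ g (Vec.replicate n c)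
∑-constant zero    c cs only g = trans (ℤ.+-identityʳ _) (ℤ.*-identityʳ (g []))
∑-constant (suc n) {k} c cs only g = begin
  ∑ (allVec (suc n) k) (λ κ → g κ ℤ.* ⟦ fresh κ (c ∷ cs) ≡ᵇ 0 ⟧)
    ≡⟨ ∑-allVec n k _ ⟩
  ∑ (allFin k) (λ d → ∑ (allVec n k) (λ κ → g (d ∷ κ) ℤ.* ⟦ fresh (d ∷ κ) (c ∷ cs) ≡ᵇ 0 ⟧))
    ≡⟨ ∑-allFin-single c (λ d d≢c → ∑-0 (allVec n k) (λ {κ} _ →
         trans (cong (λ b → g (d ∷ κ) ℤ.* ⟦ bit (not b) ℕ.+ fresh κ (d ∷ c ∷ cs) ≡ᵇ 0 ⟧)
                 (trans (only d) (==F-false (d≢c ∘ sym)))) (ℤ.*-zeroʳ (g (d ∷ κ))))) ⟩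
  ∑ (allVec n k) (λ κ → g (c ∷ κ) ℤ.* ⟦ fresh (c ∷ κ) (c ∷ cs) ≡ᵇ 0 ⟧)
    ≡⟨ ∑-cong (allVec n k) (λ κ → cong (λ b → g (c ∷ κ) ℤ.* ⟦ bit (not b) ℕ.+ fresh κ (c ∷ c ∷ cs) ≡ᵇ 0 ⟧)
         (trans (only c) (≡ᵇ-refl (toℕ c)))) ⟩
  ∑ (allVec n k) (λ κ → g (c ∷ κ) ℤ.* ⟦ fresh κ (c ∷ c ∷ cs) ≡ᵇ 0 ⟧)
    ≡⟨ ∑-constant n c (c ∷ cs) (λ d → trans (cong ((c ==F d) ∨_) (only d)) (∨-idem (c ==F d))) (g ∘ (c ∷_)) ⟩
  g (c ∷ Vec.replicate n c) ∎
  where open ≡-Reasoning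

cnt-replicate : ∀ n {k} (c d : Fin k) → cnt (Vec.replicate n c) d ≡ (if d ==F c then n else 0)
cnt-replicate zero    c d with d ==F c
... | true  = refl
... | false = refl
cnt-replicate (suc n) c d = trans (cnt-∷ c (Vec.replicate n c) d)
  (trans (cong₂ (λ b m → bit b ℕ.+ m) (≡ᵇ-sym (toℕ c) (toℕ d)) (cnt-replicate n c d)) (merge (d ==F c)))
  where
  merge : ∀ b → bit b ℕ.+ (if b then n else 0) ≡ (if b then suc n else 0)
  merge true  = refl
  merge false = refl

coefM≡ : ∀ n k α → ∑ (allFin k) (λ c → ⟦ hasContent α (Vec.replicate n c) ⟧) ≡ + coefM n k α
coefM≡ n k α = sym (trans (count-∑ℤ _ (allFin k)) (∑-cong (allFin k) (λ c → cong ⟦_⟧ (all-cong (λ d →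
  trans (≡ᵇ-sym (α d) _) (cong (_≡ᵇ α d) (sym (cnt-replicate n c d)))) (allFin k)))))

sum-cnt : ∀ {n l} (b : Vec (Fin l) n) → sum (tabulate (cnt b)) ≡ n
sum-cnt {l = l} []      = trans (sym (∑-allFin l (λ _ → 0))) (∑ℕ.∑-0 (allFin l) (λ _ → refl))
sum-cnt {suc n} {l} (x ∷ b) = begin
  sum (tabulate (cnt (x ∷ b)))
    ≡⟨ ∑-allFin l (cnt (x ∷ b)) ⟨
  ∑ℕ.∑ (allFin l) (cnt (x ∷ b))
    ≡⟨ ∑ℕ.∑-cong (allFin l) (cnt-∷ x b) ⟩
  ∑ℕ.∑ (allFin l) (λ j → bit (x ==F j) ℕ.+ cnt b j)
    ≡⟨ ∑ℕ.∑-+ _ (cnt b) (allFin l) ⟩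
  ∑ℕ.∑ (allFin l) (λ j → bit (x ==F j)) ℕ.+ ∑ℕ.∑ (allFin l) (cnt b)
    ≡⟨ cong₂ ℕ._+_ (trans (∑ℕ.∑-allFin-single x (λ j j≢x → cong bit (==F-false (j≢x ∘ sym)))) (cong bit (≡ᵇ-refl (toℕ x))))
                   (trans (∑-allFin l (cnt b)) (sum-cnt b)) ⟩
  suc n ∎
  where open ≡-Reasoning

nonempty⇒positive : ∀ xs → all (λ s → not (s ≡ᵇ 0)) xs ≡ true → All (1 ≤_) xs
nonempty⇒positive []           _ = []
nonempty⇒positive (suc x ∷ xs) h = s≤s z≤n ∷ nonempty⇒positive xs h

-- If all blocks of `b` are nonempty, its sizes are positive with sum `n`, so exactly one listed
-- partition is its type.
∑-types : ∀ {n l} (b : Vec (Fin l) n) → ∑ (partitions n) (λ μ → ⟦ isCycOSPOfType μ b ⟧) ≡ ⟦ rooted b ⟧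
∑-types {n} b with all (λ s → not (s ≡ᵇ 0)) (blockSizes b) in ne
... | false = ∑-0 (partitions n) (λ _ → refl)
... | true  = begin
  ∑ (partitions n) (λ μ → ⟦ multisetEq (blockSizes b) μ ∧ firstInBlock0 b ⟧)
    ≡⟨ ∑-cong (partitions n) (λ μ → ⟦∧⟧ (multisetEq (blockSizes b) μ) (firstInBlock0 b)) ⟩
  ∑ (partitions n) (λ μ → ⟦ multisetEq (blockSizes b) μ ⟧ ℤ.* ⟦ firstInBlock0 b ⟧)
    ≡⟨ ∑-*ʳ ⟦ firstInBlock0 b ⟧ _ (partitions n) ⟩
  ∑ (partitions n) (λ μ → ⟦ multisetEq (blockSizes b) μ ⟧) ℤ.* ⟦ firstInBlock0 b ⟧
    ≡⟨ cong (λ z → z ℤ.* ⟦ firstInBlock0 b ⟧) (∑-partitions-multisetEq n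
         (trans (cong sum (blockSizes≡ b)) (sum-cnt b)) (nonempty⇒positive (blockSizes b) ne)) ⟩
  + 1 ℤ.* ⟦ firstInBlock0 b ⟧
    ≡⟨ ℤ.*-identityˡ _ ⟩
  ⟦ firstInBlock0 b ⟧ ∎
  where open ≡-Reasoning

positive⇒length≤sum : ∀ {μ} → All (1 ≤_) μ → length μ ≤ sum μ
positive⇒length≤sum []          = z≤n
positive⇒length≤sum (1≤x ∷ pos) = ℕ.+-mono-≤ 1≤x (positive⇒length≤sum pos)

partitions-sound : ∀ n {μ} → μ ∈ partitions n → All (1 ≤_) μ × sum μ ≡ n
partitions-sound n μ∈ with ptnsAux-sound n n n μ∈
... | d , e = Desc-positive d , e

module Expansion (n k : ℕ) (α : Fin k → ℕ) where
  compatibleColourings : ∀ {l} → Vec (Fin l) (suc n) → ℤ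
  compatibleColourings b = ∑ (allVec (suc n) k) (λ κ → ⟦ compatible κ b ∧ hasContent α κ ⟧)

  -- The number `l` of blocks is kept apart from `length μ`, so that at fixed `l` the sum over `μ`
  -- can be exchanged with the sum over `b`.
  ofType : List ℕ → ℕ → ℤ
  ofType μ l = ∑ (allVec (suc n) l) (λ b → ⟦ isCycOSPOfType μ b ⟧ ℤ.* compatibleColourings b)

  cycCount*coefX : ∀ μ → + cycCount (suc n) μ ℤ.* + coefX (Gμ μ) k α ≡ ofType μ (length μ)
  cycCount*coefX μ = begin
    + cycCount (suc n) μ ℤ.* + coefX (Gμ μ) k α
      ≡⟨ cong (λ z → z ℤ.* + coefX (Gμ μ) k α) (count-∑ℤ (isCycOSPOfType μ) bs) ⟩
    ∑ bs (λ b → ⟦ isCycOSPOfType μ b ⟧) ℤ.* + coefX (Gμ μ) k α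
      ≡⟨ ∑-*ʳ (+ coefX (Gμ μ) k α) _ bs ⟨
    ∑ bs (λ b → ⟦ isCycOSPOfType μ b ⟧ ℤ.* + coefX (Gμ μ) k α)
      ≡⟨ ∑-cong bs (λ b → ⟦⟧-*-cong (isCycOSPOfType μ b) (λ h → coefX-via-blocks μ b (type⇒↭ b h) k α)) ⟩
    ofType μ (length μ) ∎
    where
    open ≡-Reasoning
    bs = allVec (suc n) (length μ)
    type⇒↭ : ∀ b → isCycOSPOfType μ b ≡ true → blockSizes b ↭ μ
    type⇒↭ b h = multisetEq⇒↭ (proj₁ (∧-true⁻ (proj₂ (∧-true⁻ {nonempty b} h))))

  -- An assignment to `l` blocks has a list of `l` sizes, which is no rearrangement of a list of
  -- another length.
  ofType-length : ∀ μ l → l ≢ length μ → ofType μ l ≡ + 0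
  ofType-length μ l l≢ = ∑-0 (allVec (suc n) l) (λ {b} _ → vanish b)
    where
    vanish : ∀ b → ⟦ isCycOSPOfType μ b ⟧ ℤ.* compatibleColourings b ≡ + 0
    vanish b with isCycOSPOfType μ b in eq
    ... | false = ℤ.*-zeroˡ (compatibleColourings b)
    ... | true  = contradiction
      (trans (sym (trans (length-map _ (allFin l)) (length-tabulate {n = l} id)))
             (↭-length (multisetEq⇒↭ {blockSizes b} (proj₁ (∧-true⁻ (proj₂ (∧-true⁻ {nonempty b} eq))))))) l≢

  -- A partition of n+1 has between 1 and n+1 parts, so its length is `suc i` for exactly one `i` in
  -- the range.
  by-length : ∀ {μ} → μ ∈ partitions (suc n) →
              sign (length μ ∸ 1) ℤ.* ofType μ (length μ) ≡ ∑ (upTo (suc n)) (λ i → sign i ℤ.* ofType μ (suc i))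
  by-length {μ} μ∈ with partitions-sound (suc n) μ∈
  by-length {[]}     μ∈ | pos , ()
  by-length {p ∷ μ′} μ∈ | pos , e = sym (∑-single (upTo⁺ (suc n))
    (∈-upTo⁺ (ℕ.≤-trans (positive⇒length≤sum pos) (ℕ.≤-reflexive e)))
    (λ {i} _ i≢ → trans (cong (λ z → sign i ℤ.* z) (ofType-length (p ∷ μ′) (suc i) (i≢ ∘ ℕ.suc-injective))) (ℤ.*-zeroʳ (sign i))))

  all-types : ∀ l → ∑ (partitions (suc n)) (λ μ → ofType μ l)
                    ≡ ∑ (allVec (suc n) l) (λ b → ⟦ rooted b ⟧ ℤ.* compatibleColourings b)
  all-types l = trans (∑-swap _ (partitions (suc n)) (allVec (suc n) l))
    (∑-cong (allVec (suc n) l) (λ b → trans (∑-*ʳ (compatibleColourings b) _ (partitions (suc n)))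
      (cong (λ z → z ℤ.* compatibleColourings b) (∑-types b))))

  by-colouring : ∀ l → ∑ (allVec (suc n) l) (λ b → ⟦ rooted b ⟧ ℤ.* compatibleColourings b)
    ≡ ∑ (allVec (suc n) k) (λ κ → ⟦ hasContent α κ ⟧ ℤ.* ∑ (allVec (suc n) l) (λ b → ⟦ rooted b ⟧ ℤ.* ⟦ compatible κ b ⟧))
  by-colouring l = begin
    ∑ bs (λ b → ⟦ rooted b ⟧ ℤ.* compatibleColourings b)
      ≡⟨ ∑-cong bs (λ b → ∑-*ˡ ⟦ rooted b ⟧ _ κs) ⟨
    ∑ bs (λ b → ∑ κs (λ κ → ⟦ rooted b ⟧ ℤ.* ⟦ compatible κ b ∧ hasContent α κ ⟧))
      ≡⟨ ∑-swap _ bs κs ⟩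
    ∑ κs (λ κ → ∑ bs (λ b → ⟦ rooted b ⟧ ℤ.* ⟦ compatible κ b ∧ hasContent α κ ⟧))
      ≡⟨ ∑-cong κs (λ κ → trans (∑-cong bs (λ b →
           trans (cong (λ z → ⟦ rooted b ⟧ ℤ.* z) (⟦∧⟧ (compatible κ b) (hasContent α κ)))
                 (rotate ⟦ rooted b ⟧ ⟦ compatible κ b ⟧ ⟦ hasContent α κ ⟧))) (∑-*ˡ ⟦ hasContent α κ ⟧ _ bs)) ⟩
    ∑ κs (λ κ → ⟦ hasContent α κ ⟧ ℤ.* ∑ bs (λ b → ⟦ rooted b ⟧ ℤ.* ⟦ compatible κ b ⟧)) ∎
    where
    open ≡-Reasoning
    bs = allVec (suc n) l
    κs = allVec (suc n) k
    rotate : ∀ a b c → a ℤ.* (b ℤ.* c) ≡ c ℤ.* (a ℤ.* b)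
    rotate = solve-∀

  alternating : ∀ (κ : Vec (Fin k) (suc n)) →
    ∑ (upTo (suc n)) (λ i → sign i ℤ.* ∑ (allVec (suc n) (suc i)) (λ b → ⟦ rooted b ⟧ ℤ.* ⟦ compatible κ b ⟧))
    ≡ ⟦ fresh (Vec.tail κ) (Vec.head κ ∷ []) ≡ᵇ 0 ⟧
  alternating (c ∷ κ) = trans (∑-cong (upTo (suc n)) (λ i → cong (λ z → sign i ℤ.* z) (∑-rooted-compatible c κ i)))
    -- After the first vertex at most `n` new colours can occur, which gives the bound t < n+1.
    (∑-sign-A (suc n) (fresh κ (c ∷ [])) (s≤s (fresh≤n κ (c ∷ []))))

  expansion : ∑ (partitions (suc n)) (λ μ → sign (length μ ∸ 1) ℤ.* (+ cycCount (suc n) μ ℤ.* + coefX (Gμ μ) k α))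
              ≡ + coefM (suc n) k α
  expansion = begin
    ∑ ps (λ μ → sign (length μ ∸ 1) ℤ.* (+ cycCount (suc n) μ ℤ.* + coefX (Gμ μ) k α))
      ≡⟨ ∑-cong∈ ps (λ {μ} μ∈ → trans (cong (λ z → sign (length μ ∸ 1) ℤ.* z) (cycCount*coefX μ)) (by-length μ∈)) ⟩
    ∑ ps (λ μ → ∑ is (λ i → sign i ℤ.* ofType μ (suc i)))
      ≡⟨ ∑-swap _ ps is ⟩
    ∑ is (λ i → ∑ ps (λ μ → sign i ℤ.* ofType μ (suc i)))
      ≡⟨ ∑-cong is (λ i → trans (∑-*ˡ (sign i) _ ps)
           (cong (λ z → sign i ℤ.* z) (trans (all-types (suc i)) (by-colouring (suc i))))) ⟩
    ∑ is (λ i → sign i ℤ.* ∑ κs (λ κ → ⟦ hasContent α κ ⟧ ℤ.* inner κ i))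
      ≡⟨ ∑-cong is (λ i → trans (sym (∑-*ˡ (sign i) _ κs))
           (∑-cong κs (λ κ → ℤ*.x∙yz≈y∙xz (sign i) ⟦ hasContent α κ ⟧ (inner κ i)))) ⟩
    ∑ is (λ i → ∑ κs (λ κ → ⟦ hasContent α κ ⟧ ℤ.* (sign i ℤ.* inner κ i)))
      ≡⟨ ∑-swap _ is κs ⟩
    ∑ κs (λ κ → ∑ is (λ i → ⟦ hasContent α κ ⟧ ℤ.* (sign i ℤ.* inner κ i)))
      ≡⟨ ∑-cong κs (λ κ → trans (∑-*ˡ ⟦ hasContent α κ ⟧ _ is) (cong (λ z → ⟦ hasContent α κ ⟧ ℤ.* z) (alternating κ))) ⟩
    ∑ κs (λ κ → ⟦ hasContent α κ ⟧ ℤ.* ⟦ fresh (Vec.tail κ) (Vec.head κ ∷ []) ≡ᵇ 0 ⟧)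
      ≡⟨ ∑-allVec n k _ ⟩
    ∑ (allFin k) (λ c → ∑ (allVec n k) (λ κ → ⟦ hasContent α (c ∷ κ) ⟧ ℤ.* ⟦ fresh κ (c ∷ []) ≡ᵇ 0 ⟧))
      ≡⟨ ∑-cong (allFin k) (λ c → ∑-constant n c [] (λ d → ∨-identityʳ (c ==F d)) (λ κ → ⟦ hasContent α (c ∷ κ) ⟧)) ⟩
    ∑ (allFin k) (λ c → ⟦ hasContent α (Vec.replicate (suc n) c) ⟧)
      ≡⟨ coefM≡ (suc n) k α ⟩
    + coefM (suc n) k α ∎
    where
    open ≡-Reasoning
    ps = partitions (suc n)
    is = upTo (suc n)
    κs = allVec (suc n) k
    inner : Vec (Fin k) (suc n) → ℕ → ℤ
    inner κ i = ∑ (allVec (suc n) (suc i)) (λ b → ⟦ rooted b ⟧ ℤ.* ⟦ compatible κ b ⟧)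

-- From integers to rationals

toℚᵘ-/1 : ∀ i → ℚ.toℚᵘ (i / 1) ℚᵘ.≃ ℚᵘ.mkℚᵘ i 0
toℚᵘ-/1 i = ℚ.toℚᵘ-fromℚᵘ (ℚᵘ.mkℚᵘ i 0)

-- Division reduces to lowest terms, so the identity is checked on unnormalised fractions, where it
-- is a ring identity after cross-multiplication.
/1-homo-+ : ∀ i j → (i ℤ.+ j) / 1 ≡ i / 1 ℚ.+ j / 1
/1-homo-+ i j = ℚ.toℚᵘ-injective (begin
  ℚ.toℚᵘ ((i ℤ.+ j) / 1)                       ≈⟨ toℚᵘ-/1 (i ℤ.+ j) ⟩
  ℚᵘ.mkℚᵘ (i ℤ.+ j) 0                          ≈⟨ ℚᵘ.*≡* (eq i j) ⟩
  ℚᵘ.mkℚᵘ i 0 ℚᵘ.+ ℚᵘ.mkℚᵘ j 0                 ≈⟨ ℚᵘ.+-cong (toℚᵘ-/1 i) (toℚᵘ-/1 j) ⟨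
  ℚ.toℚᵘ (i / 1) ℚᵘ.+ ℚ.toℚᵘ (j / 1)           ≈⟨ ℚ.toℚᵘ-homo-+ (i / 1) (j / 1) ⟨
  ℚ.toℚᵘ (i / 1 ℚ.+ j / 1)                     ∎)
  where
  open ℚᵘ.≃-Reasoning
  eq : ∀ i j → (i ℤ.+ j) ℤ.* + 1 ≡ (i ℤ.* + 1 ℤ.+ j ℤ.* + 1) ℤ.* + 1
  eq = solve-∀

/1-homo-* : ∀ i j → (i ℤ.* j) / 1 ≡ i / 1 ℚ.* (j / 1)
/1-homo-* i j = ℚ.toℚᵘ-injective (begin
  ℚ.toℚᵘ ((i ℤ.* j) / 1)                       ≈⟨ toℚᵘ-/1 (i ℤ.* j) ⟩
  ℚᵘ.mkℚᵘ i 0 ℚᵘ.* ℚᵘ.mkℚᵘ j 0                 ≈⟨ ℚᵘ.*-cong (toℚᵘ-/1 i) (toℚᵘ-/1 j) ⟨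
  ℚ.toℚᵘ (i / 1) ℚᵘ.* ℚ.toℚᵘ (j / 1)           ≈⟨ ℚ.toℚᵘ-homo-* (i / 1) (j / 1) ⟨
  ℚ.toℚᵘ (i / 1 ℚ.* (j / 1))                   ∎)
  where open ℚᵘ.≃-Reasoning

/1-homo-neg : ∀ i → (ℤ.- i) / 1 ≡ ℚ.- (i / 1)
/1-homo-neg i = ℚ.toℚᵘ-injective (begin
  ℚ.toℚᵘ ((ℤ.- i) / 1)      ≈⟨ toℚᵘ-/1 (ℤ.- i) ⟩
  ℚᵘ.- ℚᵘ.mkℚᵘ i 0          ≈⟨ ℚᵘ.-‿cong (toℚᵘ-/1 i) ⟨
  ℚᵘ.- ℚ.toℚᵘ (i / 1)       ≈⟨ ℚ.toℚᵘ-homo‿- (i / 1) ⟨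
  ℚ.toℚᵘ (ℚ.- (i / 1))      ∎)
  where open ℚᵘ.≃-Reasoning

signℚ≡ : ∀ j → signℚ j ≡ sign j / 1
signℚ≡ zero    = refl
signℚ≡ (suc j) = trans (cong ℚ.-_ (signℚ≡ j)) (sym (/1-homo-neg (sign j)))

sumℚ-/1 : ∀ {X : Set} (f : X → ℤ) xs → sumℚ (map (λ x → f x / 1) xs) ≡ ∑ xs f / 1
sumℚ-/1 f []       = refl
sumℚ-/1 f (x ∷ xs) = trans (cong (λ z → f x / 1 ℚ.+ z) (sumℚ-/1 f xs)) (sym (/1-homo-+ (f x) (∑ xs f)))

exact-quotient : ∀ {p} c d .{{_ : ℕ.NonZero d}} → c ℕ.* d ≡ p → + p / d ≡ fromℕℚ c
-- `mkℚᵘ` stores the denominator minus one, hence `d` and `0`.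
exact-quotient {p} c (suc d) e = ℚ.fromℚᵘ-cong {ℚᵘ.mkℚᵘ (+ p) d} {ℚᵘ.mkℚᵘ (+ c) 0}
  (ℚᵘ.*≡* (trans (ℤ.*-identityʳ (+ p)) (trans (cong +_ (sym e)) (ℤ.pos-* c (suc d)))))

-- This is the second claim, and it also turns the coefficients of the first claim into integers.
cμ≡cycCount : ∀ n {μ} → μ ∈ partitions (suc n) → cμ (suc n) μ ≡ fromℕℚ (cycCount (suc n) μ)
cμ≡cycCount n {μ} μ∈ = exact-quotient (cycCount (suc n) μ) (denom (suc n) μ) {{prodFac-nz (denomList (suc n) μ)}}
  (let (pos , e) = partitions-sound (suc n) μ∈ in cycCount*denom n μ e pos)

term≡ : ∀ n k α {μ} → μ ∈ partitions (suc n) →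
  signℚ (ℓ μ ∸ 1) ℚ.* cμ (suc n) μ ℚ.* fromℕℚ (coefX (Gμ μ) k α)
  ≡ (sign (length μ ∸ 1) ℤ.* (+ cycCount (suc n) μ ℤ.* + coefX (Gμ μ) k α)) / 1
term≡ n k α {μ} μ∈ = begin
  signℚ (ℓ μ ∸ 1) ℚ.* cμ (suc n) μ ℚ.* (x / 1)
    ≡⟨ cong₂ (λ s c → s ℚ.* c ℚ.* (x / 1)) (signℚ≡ (length μ ∸ 1)) (cμ≡cycCount n μ∈) ⟩
  s / 1 ℚ.* (c / 1) ℚ.* (x / 1)
    ≡⟨ ℚ.*-assoc (s / 1) (c / 1) (x / 1) ⟩
  s / 1 ℚ.* (c / 1 ℚ.* (x / 1))
    ≡⟨ cong (λ z → s / 1 ℚ.* z) (/1-homo-* c x) ⟨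
  s / 1 ℚ.* ((c ℤ.* x) / 1)
    ≡⟨ /1-homo-* s (c ℤ.* x) ⟨
  (s ℤ.* (c ℤ.* x)) / 1 ∎
  where
  open ≡-Reasoning
  s = sign (length μ ∸ 1)
  c = + cycCount (suc n) μ
  x = + coefX (Gμ μ) k α

open import Data.Rational using (_*_)

theorem4p2 : (n : ℕ) → 1 ≤ n →
    ((k : ℕ) (α : Fin k → ℕ) →
    fromℕℚ (coefM n k α)
    ≡ sumℚ (map (λ μ → signℚ (ℓ μ Data.Nat.∸ 1) * cμ n μ * fromℕℚ (coefX (Gμ μ) k α)) (partitions n)))
    × ((μ : _) → μ ∈ partitions n → cμ n μ ≡ fromℕℚ (cycCount n μ))
theorem4p2 (suc n) _ =
  (λ k α → sym (trans (cong sumℚ (map-cong-local (All.tabulate (term≡ n k α))))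
                 (trans (sumℚ-/1 _ (partitions (suc n))) (cong (_/ 1) (Expansion.expansion n k α))))) ,
  (λ μ → cμ≡cycCount n)
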